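{- Let $\dot G$ be a signed graph with spectrum $\{[-\lambda]^{m-2},[0]^2,[\lambda]^{m-2}\}$. Suppose every vertex of its underlying graph $G$ has degree $\lambda^2$, $\lambda^2-1$, or $\lambda^2-2$, and at least $\lambda^2+1$ vertices have degree $\lambda^2-1$. Then there is a signed graph $\dot H$ with spectrum $\{[-\lambda]^{m-1},[0]^1,[\lambda]^{m-1}\}$, all of whose vertices have degree $\lambda^2$ or $\lambda^2-1$, containing a vertex whose deletion yields $\dot G$.
   Context: A signed graph $\dot G=(G,\sigma)$ consists of a simple graph $G$ and $\sigma:E(G)\to\{1,-1\}$; its adjacency matrix is that of $G$ with entries of negative edges replaced by $-1$, and its spectrum is the multiset of eigenvalues of this matrix. The degree of a vertex is its degree in the underlying graph. The notation $[\mu]^k$ means eigenvalue $\mu$ with multiplicity $k$. -}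

module Defs where

open import Data.Nat using (ℕ; zero; suc; _+_; _≤_)
open import Data.Integer as ℤ using (ℤ; +_; _-_; _*_; -_)
open import Data.Fin using (Fin; zero; suc; punchIn; _≟_)
open import Data.Bool using (Bool; true; false; if_then_else_)
open import Relation.Nullary using (Dec; yes; no; ¬_)
open import Relation.Binary.PropositionalEquality using (_≡_)

data Entry : Set where
  none pos neg : Entry

record SignedGraph (n : ℕ) : Set where
  field
    adj       : Fin n → Fin n → Entry
    symmetric : ∀ i j → adj i j ≡ adj j i
    loopless  : ∀ i → adj i i ≡ none
open SignedGraph public

entryℤ : Entry → ℤ
entryℤ none = + 0
entryℤ pos  = + 1
entryℤ neg  = - (+ 1)

adjMatrix : ∀ {n} → SignedGraph n → Fin n → Fin n → ℤ
adjMatrix G i j = entryℤ (adj G i j)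

sumℤ : ∀ {n} → (Fin n → ℤ) → ℤ
sumℤ {zero}  f = + 0
sumℤ {suc n} f = f zero ℤ.+ sumℤ (λ i → f (suc i))

count : ∀ {n} → (Fin n → Bool) → ℕ
count {zero}  p = 0
count {suc n} p = (if p zero then 1 else 0) + count (λ i → p (suc i))

isEdge : Entry → Bool
isEdge none = false
isEdge pos  = true
isEdge neg  = true

degree : ∀ {n} → SignedGraph n → Fin n → ℕ
degree G i = count (λ j → isEdge (adj G i j))

sgn : ℕ → ℤ
sgn zero          = + 1
sgn (suc zero)    = - (+ 1)
sgn (suc (suc k)) = sgn k

toℕ' : ∀ {n} → Fin n → ℕ
toℕ' zero    = 0
toℕ' (suc i) = suc (toℕ' i)

det : ∀ {n} → (Fin n → Fin n → ℤ) → ℤ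
det {zero}  M = + 1
det {suc n} M =
  sumℤ (λ j → sgn (toℕ' j) * (M zero j * det (λ r c → M (suc r) (punchIn j c))))

δ : ∀ {n} → Fin n → Fin n → ℤ
δ i j with i ≟ j
... | yes _ = + 1
... | no  _ = + 0

charPolyAt : ∀ {n} → (Fin n → Fin n → ℤ) → ℤ → ℤ
charPolyAt A x = det (λ i j → (x * δ i j) - A i j)

_^ℤ_ : ℤ → ℕ → ℤ
x ^ℤ zero  = + 1
x ^ℤ suc k = x * (x ^ℤ k)

-- The characteristic polynomial of A equals the integer polynomial p
-- (checked pointwise on ℤ; two polynomials agreeing on all of ℤ are equal).
HasCharPoly : ∀ {n} → (Fin n → Fin n → ℤ) → (ℤ → ℤ) → Set
HasCharPoly A p = ∀ x → charPolyAt A x ≡ p x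

-- Spectrum {[-√k]^a, [0]^b, [√k]^a}  ⇔  char. poly x^b (x² - k)^a
-- (adjacency matrices are symmetric, hence diagonalisable).
HasSpectrum± : ∀ {n} → SignedGraph n → (k a b : ℕ) → Set
HasSpectrum± G k a b =
  HasCharPoly (adjMatrix G) (λ x → (x ^ℤ b) * (((x * x) - (+ k)) ^ℤ a))

DeletionYields : ∀ {n} → SignedGraph (suc n) → Fin (suc n) → SignedGraph n → Set
DeletionYields H v G = ∀ i j → adj H (punchIn v i) (punchIn v j) ≡ adj G i j

_==ℕ_ : ℕ → ℕ → Bool
zero  ==ℕ zero  = true
suc m ==ℕ suc n = m ==ℕ n
_     ==ℕ _     = false

{-# OPTIONS --safe #-}
module Submission where

-- Let A be the adjacency matrix of G.  Since A is symmetric, Cayley–Hamilton gives A (A² − k) = 0,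
-- so the integer matrix P = k − A² satisfies A P = 0 and P² = k P, and its diagonal entry at v is
-- k − deg v.  A row P_u with P_uu = 1 has squared norm k, hence vanishes at some of the k + 1
-- vertices v with P_vv = 1.  As 0 is only a double eigenvalue, P = P_u P_uᵀ + P_v P_vᵀ, and the
-- diagonal of P being at most 2, P_u has entries in {0, ±1}.  Join a new vertex to G with signs P_u:
-- the degree at w becomes k − (P_vw)², and det (x − A) is multiplied by (x² − k) / x.
--
-- No polynomial arithmetic is needed.  For every integer x the vector p(A) e_j is p(x) e_j modulo
-- the image of x − A, and p(x) e_j lies in that image when p(x) = det (x − A); a vector lying in
-- the image of x − A for all large x is 0.  Likewise, by Cramer's rule, three independent null
-- vectors would force x³ to divide a fixed nonzero multiple of det (x − A) for every x.

open import Defs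
open import Data.Nat using (ℕ; zero; suc; _+_; _∸_; _≤_; z≤n; s≤s)
import Data.Nat as ℕ
import Data.Nat.Properties as ℕₚ
open import Data.Fin using (Fin; zero; suc; punchIn; punchOut; inject₁; toℕ; _≟_)
import Data.Fin as Fin
import Data.Fin.Properties as Finₚ
open import Data.Fin.Induction using (<-weakInduction)
open import Data.Integer as ℤ
  using (ℤ; +_; -[1+_]; ∣_∣; +≤+; _-_; _*_; -_) renaming (_+_ to _+ℤ_)
import Data.Integer.Properties as ℤₚ
open import Algebra.Properties.AbelianGroup ℤₚ.+-0-abelianGroup using (∙-cancelʳ)
open import Data.Integer.Tactic.RingSolver using (solve-∀)
open import Data.Bool using (Bool; true; false; if_then_else_)
open import Data.Sum using (_⊎_; inj₁; inj₂)
open import Data.Product using (Σ; Σ-syntax; _×_; _,_; proj₁; proj₂)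
open import Function using (_∘_)
open import Relation.Nullary using (yes; no; contradiction)
open import Relation.Binary.Definitions using (tri<; tri≈; tri>)
open import Relation.Binary.PropositionalEquality
  using (_≡_; _≢_; refl; sym; trans; cong; cong₂; subst; subst₂; module ≡-Reasoning)

open ≡-Reasoning

private variable
  n : ℕ

Vector : ℕ → Set
Vector n = Fin n → ℤ

Matrix : ℕ → Set
Matrix n = Fin n → Vector n

-- Finite sums

sum-cong : {f g : Vector n} → (∀ i → f i ≡ g i) → sumℤ f ≡ sumℤ g
sum-cong {zero}  f≡g = refl
sum-cong {suc n} f≡g = cong₂ _+ℤ_ (f≡g zero) (sum-cong (f≡g ∘ suc))

sum-zero : {f : Vector n} → (∀ i → f i ≡ + 0) → sumℤ f ≡ + 0
sum-zero {zero}  f≡0 = refl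
sum-zero {suc n} f≡0 = cong₂ _+ℤ_ (f≡0 zero) (sum-zero (f≡0 ∘ suc))

sum-linear : ∀ s (f g : Vector n) →
  sumℤ (λ i → s * f i +ℤ g i) ≡ s * sumℤ f +ℤ sumℤ g
sum-linear {zero}  s f g = cong (ℤ._+ + 0) (sym (ℤₚ.*-zeroʳ s))
sum-linear {suc n} s f g =
  trans (cong ((s * f zero +ℤ g zero) +ℤ_) (sum-linear s (f ∘ suc) (g ∘ suc)))
        (rearrange s (f zero) (g zero) (sumℤ (f ∘ suc)) (sumℤ (g ∘ suc)))
  where
  rearrange : ∀ s a b A B →
    (s * a +ℤ b) +ℤ (s * A +ℤ B) ≡ s * (a +ℤ A) +ℤ (b +ℤ B)
  rearrange = solve-∀

sum-+ : ∀ (f g : Vector n) → sumℤ (λ i → f i +ℤ g i) ≡ sumℤ f +ℤ sumℤ g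
sum-+ f g = begin
  sumℤ (λ i → f i +ℤ g i)          ≡⟨ sum-cong (λ i → cong (ℤ._+ g i) (ℤₚ.*-identityˡ (f i))) ⟨
  sumℤ (λ i → + 1 * f i +ℤ g i)    ≡⟨ sum-linear (+ 1) f g ⟩
  + 1 * sumℤ f +ℤ sumℤ g           ≡⟨ cong (ℤ._+ sumℤ g) (ℤₚ.*-identityˡ (sumℤ f)) ⟩
  sumℤ f +ℤ sumℤ g                 ∎

sum-* : ∀ s (f : Vector n) → sumℤ (λ i → s * f i) ≡ s * sumℤ f
sum-* {zero}  s f = sym (ℤₚ.*-zeroʳ s)
sum-* {suc n} s f =
  trans (cong (s * f zero +ℤ_) (sum-* s (f ∘ suc))) (sym (ℤₚ.*-distribˡ-+ s (f zero) _))

sum-swap : ∀ {m n} (f : Fin m → Fin n → ℤ) →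
  sumℤ (λ i → sumℤ (f i)) ≡ sumℤ (λ j → sumℤ (λ i → f i j))
sum-swap {zero} {n} f = sym (sum-zero {n} (λ j → refl))
sum-swap {suc m} f =
  trans (cong (sumℤ (f zero) +ℤ_) (sum-swap (f ∘ suc))) (sym (sum-+ (f zero) (λ j → sumℤ (λ i → f (suc i) j))))

sum-single : ∀ j (f : Vector n) → (∀ i → i ≢ j → f i ≡ + 0) → sumℤ f ≡ f j
sum-single zero f f≡0 =
  trans (cong (f zero +ℤ_) (sum-zero (λ i → f≡0 (suc i) (λ ())))) (ℤₚ.+-identityʳ _)
sum-single (suc j) f f≡0 =
  trans (cong₂ _+ℤ_ (f≡0 zero (λ ()))
                     (sum-single j (f ∘ suc) (λ i i≢j → f≡0 (suc i) (i≢j ∘ Finₚ.suc-injective))))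
        (ℤₚ.+-identityˡ _)

sum-adjacent : ∀ (i : Fin n) (f : Vector (suc n)) →
  (∀ l → l ≢ inject₁ i → l ≢ suc i → f l ≡ + 0) →
  sumℤ f ≡ f (inject₁ i) +ℤ f (suc i)
sum-adjacent zero f f≡0 = cong (f zero +ℤ_)
  (sum-single zero (f ∘ suc)
    (λ i i≢0 → f≡0 (suc i) (λ ()) (i≢0 ∘ Finₚ.suc-injective)))
sum-adjacent (suc i) f f≡0 =
  trans (cong₂ _+ℤ_ (f≡0 zero (λ ()) (λ ()))
          (sum-adjacent i (f ∘ suc) (λ l p q →
            f≡0 (suc l) (p ∘ Finₚ.suc-injective) (q ∘ Finₚ.suc-injective))))
        (ℤₚ.+-identityˡ _)

sum-mono : {f g : Vector n} → (∀ i → f i ℤ.≤ g i) → sumℤ f ℤ.≤ sumℤ g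
sum-mono {zero}  f≤g = ℤₚ.≤-refl
sum-mono {suc n} f≤g = ℤₚ.+-mono-≤ (f≤g zero) (sum-mono (f≤g ∘ suc))

sum-nonneg : {f : Vector n} → (∀ i → + 0 ℤ.≤ f i) → + 0 ℤ.≤ sumℤ f
sum-nonneg {zero}  f≥0 = ℤₚ.≤-refl
sum-nonneg {suc n} f≥0 = ℤₚ.+-mono-≤ (f≥0 zero) (sum-nonneg (f≥0 ∘ suc))

sum-const : ∀ n c → sumℤ {n} (λ _ → c) ≡ + n * c
sum-const zero    c = sym (ℤₚ.*-zeroˡ c)
sum-const (suc n) c = trans (cong (c +ℤ_) (sum-const n c)) (sym (ℤₚ.suc-* (+ n) c))

-- Determinants

minor : Matrix (suc n) → Fin (suc n) → Matrix n
minor M l r c = M (suc r) (punchIn l c)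

laplaceTerm : Matrix (suc n) → Vector (suc n)
laplaceTerm M l = sgn (toℕ' l) * (M zero l * det (minor M l))

det-cong : {M M′ : Matrix n} → (∀ r c → M r c ≡ M′ r c) → det M ≡ det M′
det-cong {zero}  M≡M′ = refl
det-cong {suc n} M≡M′ = sum-cong λ j → cong (sgn (toℕ' j) *_)
  (cong₂ _*_ (M≡M′ zero j) (det-cong (λ r c → M≡M′ (suc r) (punchIn j c))))

punchIn-avoids : ∀ {l j : Fin (suc n)} (l≢j : l ≢ j) c → c ≢ punchOut l≢j → punchIn l c ≢ j
punchIn-avoids {l = l} l≢j c c≢ eq =
  c≢ (Finₚ.punchIn-injective l _ _ (trans eq (sym (Finₚ.punchIn-punchOut l≢j))))

-- The single form s a + b covers additivity and scaling at once. In the expansion along the first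
-- row, the term at column j is linear through its entry while its minor is unchanged; every other
-- term is linear through its minor, by induction at the shifted position of column j.
det-linear : ∀ s j (M M₁ M₂ : Matrix n) →
  (∀ r → M r j ≡ s * M₁ r j +ℤ M₂ r j) →
  (∀ r c → c ≢ j → M r c ≡ M₁ r c) →
  (∀ r c → c ≢ j → M r c ≡ M₂ r c) →
  det M ≡ s * det M₁ +ℤ det M₂
det-linear {suc n} s j M M₁ M₂ at off₁ off₂ =
  trans (sum-cong term) (sum-linear s (laplaceTerm M₁) (laplaceTerm M₂))
  where
  atj : ∀ σ s p q d → σ * ((s * p +ℤ q) * d) ≡ s * (σ * (p * d)) +ℤ σ * (q * d)
  atj = solve-∀
  offj : ∀ σ s p d e → σ * (p * (s * d +ℤ e)) ≡ s * (σ * (p * d)) +ℤ σ * (p * e)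
  offj = solve-∀
  term : ∀ l → laplaceTerm M l ≡ s * laplaceTerm M₁ l +ℤ laplaceTerm M₂ l
  term l with l ≟ j
  ... | yes refl = begin
    σ * (M zero l * d)
      ≡⟨ cong (λ t → σ * (t * d)) (at zero) ⟩
    σ * ((s * M₁ zero l +ℤ M₂ zero l) * d)
      ≡⟨ atj σ s (M₁ zero l) (M₂ zero l) d ⟩
    s * (σ * (M₁ zero l * d)) +ℤ σ * (M₂ zero l * d)
      ≡⟨ cong₂ (λ d₁ d₂ → s * (σ * (M₁ zero l * d₁)) +ℤ σ * (M₂ zero l * d₂))
           (det-cong (λ r c → off₁ (suc r) (punchIn l c) (Finₚ.punchInᵢ≢i l c)))
           (det-cong (λ r c → off₂ (suc r) (punchIn l c) (Finₚ.punchInᵢ≢i l c))) ⟩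
    s * laplaceTerm M₁ l +ℤ laplaceTerm M₂ l ∎
    where
    σ = sgn (toℕ' l)
    d = det (minor M l)
  ... | no l≢j = begin
    σ * (M zero l * det (minor M l))
      ≡⟨ cong (λ t → σ * (M zero l * t)) minors ⟩
    σ * (M zero l * (s * det (minor M₁ l) +ℤ det (minor M₂ l)))
      ≡⟨ offj σ s (M zero l) _ _ ⟩
    s * (σ * (M zero l * det (minor M₁ l))) +ℤ σ * (M zero l * det (minor M₂ l))
      ≡⟨ cong₂ (λ p q → s * (σ * (p * det (minor M₁ l))) +ℤ σ * (q * det (minor M₂ l)))
           (off₁ zero l l≢j) (off₂ zero l l≢j) ⟩
    s * laplaceTerm M₁ l +ℤ laplaceTerm M₂ l ∎
    where
    σ = sgn (toℕ' l)
    minors : det (minor M l) ≡ s * det (minor M₁ l) +ℤ det (minor M₂ l)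
    minors = det-linear s (punchOut l≢j) (minor M l) (minor M₁ l) (minor M₂ l)
      (λ r → subst (λ c → M (suc r) c ≡ s * M₁ (suc r) c +ℤ M₂ (suc r) c)
                   (sym (Finₚ.punchIn-punchOut l≢j)) (at (suc r)))
      (λ r c c≢ → off₁ (suc r) (punchIn l c) (punchIn-avoids l≢j c c≢))
      (λ r c c≢ → off₂ (suc r) (punchIn l c) (punchIn-avoids l≢j c c≢))

-- Deleting one or the other of two neighbouring columns leaves the same columns in the same order,
-- except at one place, which holds the surviving neighbour. Hence the two minors agree once the
-- neighbours are equal.
punchIn-inject₁-suc : ∀ (i c : Fin n) →
  punchIn (inject₁ i) c ≡ punchIn (suc i) c
  ⊎ (punchIn (inject₁ i) c ≡ suc i × punchIn (suc i) c ≡ inject₁ i)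
punchIn-inject₁-suc zero    zero    = inj₂ (refl , refl)
punchIn-inject₁-suc zero    (suc c) = inj₁ refl
punchIn-inject₁-suc (suc i) zero    = inj₁ refl
punchIn-inject₁-suc (suc i) (suc c) with punchIn-inject₁-suc i c
... | inj₁ p       = inj₁ (cong suc p)
... | inj₂ (p , q) = inj₂ (cong suc p , cong suc q)

-- Deleting a third column leaves the two neighbours adjacent; i′ is their new position. This lets
-- the induction in `det-adjacent-columns` pass to minors.
punchIn-adjacent : ∀ (l : Fin (suc (suc n))) (i : Fin (suc n)) →
  l ≢ inject₁ i → l ≢ suc i →
  Σ[ i′ ∈ Fin n ] (punchIn l (inject₁ i′) ≡ inject₁ i × punchIn l (suc i′) ≡ suc i)
punchIn-adjacent zero           zero    p q = contradiction refl p
punchIn-adjacent zero           (suc i) p q = i , refl , refl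
punchIn-adjacent (suc zero)     zero    p q = contradiction refl q
punchIn-adjacent {suc n} (suc (suc l)) zero p q = zero , refl , refl
punchIn-adjacent {suc n} (suc l) (suc i) p q
  with punchIn-adjacent l i (p ∘ cong suc) (q ∘ cong suc)
... | i′ , e , e′ = suc i′ , cong suc e , cong suc e′

toℕ'-inject₁ : (i : Fin n) → toℕ' (inject₁ i) ≡ toℕ' i
toℕ'-inject₁ zero    = refl
toℕ'-inject₁ (suc i) = cong suc (toℕ'-inject₁ i)

sgn-suc : ∀ k → sgn (suc k) ≡ - sgn k
sgn-suc zero          = refl
sgn-suc (suc zero)    = refl
sgn-suc (suc (suc k)) = sgn-suc k

-- Minors that keep both equal columns vanish by induction. The two remaining terms of the expansion
-- have equal entries, equal minors and opposite signs.
det-adjacent-columns : ∀ (i : Fin n) (M : Matrix (suc n)) →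
  (∀ r → M r (inject₁ i) ≡ M r (suc i)) → det M ≡ + 0
det-adjacent-columns {suc n} i M eq =
  trans (sum-adjacent i (laplaceTerm M) vanish) cancel
  where
  annihilate : ∀ σ p → σ * (p * + 0) ≡ + 0
  annihilate = solve-∀
  vanish : ∀ l → l ≢ inject₁ i → l ≢ suc i → laplaceTerm M l ≡ + 0
  vanish l p q with punchIn-adjacent l i p q
  ... | i′ , e , e′ = trans
    (cong (λ d → sgn (toℕ' l) * (M zero l * d))
      (det-adjacent-columns i′ (minor M l)
        (λ r → trans (cong (M (suc r)) e) (trans (eq (suc r)) (cong (M (suc r)) (sym e′))))))
    (annihilate (sgn (toℕ' l)) (M zero l))
  minors : ∀ r c → minor M (inject₁ i) r c ≡ minor M (suc i) r c
  minors r c with punchIn-inject₁-suc i c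
  ... | inj₁ p       = cong (M (suc r)) p
  ... | inj₂ (p , q) = trans (cong (M (suc r)) p) (trans (sym (eq (suc r))) (cong (M (suc r)) (sym q)))
  opposite : ∀ σ t → σ * t +ℤ - σ * t ≡ + 0
  opposite = solve-∀
  cancel : laplaceTerm M (inject₁ i) +ℤ laplaceTerm M (suc i) ≡ + 0
  cancel = trans
    (cong₂ _+ℤ_
      (cong₂ _*_ (cong sgn (toℕ'-inject₁ i)) (cong₂ _*_ (eq zero) (det-cong minors)))
      (cong (_* (M zero (suc i) * det (minor M (suc i)))) (sgn-suc (toℕ' i))))
    (opposite (sgn (toℕ' i)) (M zero (suc i) * det (minor M (suc i))))

setColumn : Fin n → Vector n → Matrix n → Matrix n
setColumn j v M r c with c ≟ j
... | yes _ = v r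
... | no  _ = M r c

setColumn-at : ∀ j (v : Vector n) M r → setColumn j v M r j ≡ v r
setColumn-at j v M r with j ≟ j
... | yes _   = refl
... | no j≢j = contradiction refl j≢j

setColumn-off : ∀ j (v : Vector n) M r c → c ≢ j → setColumn j v M r c ≡ M r c
setColumn-off j v M r c c≢j with c ≟ j
... | yes c≡j = contradiction c≡j c≢j
... | no  _   = refl

setColumn-cong : ∀ j {u v : Vector n} {M N : Matrix n} → (∀ r → u r ≡ v r) →
  (∀ r c → c ≢ j → M r c ≡ N r c) → ∀ r c → setColumn j u M r c ≡ setColumn j v N r c
setColumn-cong j u≡v M≡N r c with c ≟ j
... | yes _   = u≡v r
... | no  c≢j = M≡N r c c≢j

setColumn-self : ∀ j (M : Matrix n) r c → setColumn j (λ r → M r j) M r c ≡ M r c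
setColumn-self j M r c with c ≟ j
... | yes refl = refl
... | no _     = refl

det-setColumn-linear : ∀ s j (u v : Vector n) M →
  det (setColumn j (λ r → s * u r +ℤ v r) M)
    ≡ s * det (setColumn j u M) +ℤ det (setColumn j v M)
det-setColumn-linear s j u v M = det-linear s j _ _ _
  (λ r → trans (setColumn-at j _ M r)
    (sym (cong₂ (λ a b → s * a +ℤ b) (setColumn-at j u M r) (setColumn-at j v M r))))
  (λ r c c≢j → trans (setColumn-off j _ M r c c≢j) (sym (setColumn-off j u M r c c≢j)))
  (λ r c c≢j → trans (setColumn-off j _ M r c c≢j) (sym (setColumn-off j v M r c c≢j)))

-- A zero column v satisfies v = -v + v, so by linearity the determinant d satisfies d = -d + d = 0.
det-setColumn-zero : ∀ j (v : Vector n) M → (∀ r → v r ≡ + 0) → det (setColumn j v M) ≡ + 0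
det-setColumn-zero j v M v≡0 = begin
  det (setColumn j v M)
    ≡⟨ det-cong (setColumn-cong j (λ r → trans (v≡0 r) (trivial (v r))) (λ _ _ _ → refl)) ⟩
  det (setColumn j (λ r → - + 1 * v r +ℤ v r) M)
    ≡⟨ det-setColumn-linear (- + 1) j v v M ⟩
  - + 1 * det (setColumn j v M) +ℤ det (setColumn j v M)
    ≡⟨ trivial (det (setColumn j v M)) ⟨
  + 0 ∎
  where
  trivial : ∀ t → + 0 ≡ - + 1 * t +ℤ t
  trivial = solve-∀

det-setColumn-sum : ∀ {k} j (y : Vector k) (V : Fin k → Vector n) M →
  det (setColumn j (λ r → sumℤ (λ c → y c * V c r)) M)
    ≡ sumℤ (λ c → y c * det (setColumn j (V c) M))
det-setColumn-sum {k = zero}  j y V M = det-setColumn-zero j _ M (λ _ → refl)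
det-setColumn-sum {k = suc k} j y V M =
  trans (det-setColumn-linear (y zero) j (V zero) _ M)
        (cong (y zero * det (setColumn j (V zero) M) +ℤ_) (det-setColumn-sum j (y ∘ suc) (V ∘ suc) M))

setColumn-comm : ∀ {p q} (u v : Vector n) M → p ≢ q →
  ∀ r c → setColumn p u (setColumn q v M) r c ≡ setColumn q v (setColumn p u M) r c
setColumn-comm {p = p} {q} u v M p≢q r c with c ≟ p | c ≟ q
... | yes refl | yes c≡q = contradiction c≡q p≢q
... | yes refl | no _    = sym (setColumn-at p u M r)
... | no _     | yes refl = setColumn-at q v M r
... | no c≢p   | no c≢q  =
  trans (setColumn-off q v M r c c≢q) (sym (setColumn-off p u M r c c≢p))

-- Polarisation: put u + v in both columns, expand, and drop the two terms with a repeated vector.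
det-antisymmetric : ∀ {p q} (M : Matrix n) → p ≢ q →
  (∀ t → det (setColumn p t (setColumn q t M)) ≡ + 0) →
  ∀ u v → det (setColumn p u (setColumn q v M)) ≡ - det (setColumn p v (setColumn q u M))
det-antisymmetric {n} {p} {q} M p≢q alternating u v =
  polarise (D u u) (D u v) (D v u) (D v v) (alternating u) (alternating v) expand
  where
  D : Vector n → Vector n → ℤ
  D a b = det (setColumn p a (setColumn q b M))
  w : Vector n
  w r = + 1 * u r +ℤ v r
  linearʳ : ∀ t → D t w ≡ + 1 * D t u +ℤ D t v
  linearʳ t = begin
    D t w
      ≡⟨ det-cong (setColumn-comm t w M p≢q) ⟩
    det (setColumn q w (setColumn p t M))
      ≡⟨ det-setColumn-linear (+ 1) q u v (setColumn p t M) ⟩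
    + 1 * det (setColumn q u (setColumn p t M)) +ℤ det (setColumn q v (setColumn p t M))
      ≡⟨ cong₂ (λ a b → + 1 * a +ℤ b) (det-cong (setColumn-comm t u M p≢q))
                                      (det-cong (setColumn-comm t v M p≢q)) ⟨
    + 1 * D t u +ℤ D t v ∎
  expand : + 0 ≡ + 1 * (+ 1 * D u u +ℤ D u v) +ℤ (+ 1 * D v u +ℤ D v v)
  expand = begin
    + 0                   ≡⟨ alternating w ⟨
    D w w                 ≡⟨ det-setColumn-linear (+ 1) p u v (setColumn q w M) ⟩
    + 1 * D u w +ℤ D v w  ≡⟨ cong₂ (λ a b → + 1 * a +ℤ b) (linearʳ u) (linearʳ v) ⟩
    + 1 * (+ 1 * D u u +ℤ D u v) +ℤ (+ 1 * D v u +ℤ D v v) ∎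
  polarise : ∀ uu uv vu vv → uu ≡ + 0 → vv ≡ + 0 →
    + 0 ≡ + 1 * (+ 1 * uu +ℤ uv) +ℤ (+ 1 * vu +ℤ vv) → uv ≡ - vu
  polarise _ uv vu _ refl refl eq = begin
    uv                                                         ≡⟨ shift uv vu ⟩
    + 1 * (+ 1 * + 0 +ℤ uv) +ℤ (+ 1 * vu +ℤ + 0) +ℤ - vu       ≡⟨ cong (_+ℤ - vu) eq ⟨
    + 0 +ℤ - vu                                                ≡⟨ ℤₚ.+-identityˡ (- vu) ⟩
    - vu                                                       ∎
    where
    shift : ∀ a b → a ≡ + 1 * (+ 1 * + 0 +ℤ a) +ℤ (+ 1 * b +ℤ + 0) +ℤ - b
    shift = solve-∀

inject₁≢suc : (i : Fin n) → inject₁ i ≢ suc i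
inject₁≢suc (suc i) eq = inject₁≢suc i (Finₚ.suc-injective eq)

-- Induction on j: exchanging the columns j and j + 1 brings the two equal columns closer.
det-equal-columns-< : ∀ (j : Fin (suc n)) (M : Matrix (suc n)) i → i Fin.< j →
  (∀ r → M r i ≡ M r j) → det M ≡ + 0
det-equal-columns-< {n} = <-weakInduction Vanishes (λ _ _ ()) step
  where
  Vanishes : Fin (suc n) → Set
  Vanishes j = ∀ (M : Matrix (suc n)) i → i Fin.< j → (∀ r → M r i ≡ M r j) → det M ≡ + 0
  step : ∀ j → Vanishes (inject₁ j) → Vanishes (suc j)
  step j IH M i i<1+j eq with i ≟ inject₁ j
  ... | yes refl = det-adjacent-columns j M eq
  ... | no i≢j = begin
    det M
      ≡⟨ det-cong restore ⟩
    det (setColumn p (λ r → M r p) (setColumn q (λ r → M r q) M))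
      ≡⟨ det-antisymmetric M (inject₁≢suc j) alternating (λ r → M r p) (λ r → M r q) ⟩
    - det N
      ≡⟨ cong -_ (IH N i i<j N-eq) ⟩
    + 0 ∎
    where
    p q : Fin (suc n)
    p = inject₁ j
    q = suc j
    N : Matrix (suc n)
    N = setColumn p (λ r → M r q) (setColumn q (λ r → M r p) M)
    i<j : i Fin.< p
    i<j = Finₚ.≤∧≢⇒< (subst (toℕ i ≤_) (sym (Finₚ.toℕ-inject₁ j)) (ℕ.s≤s⁻¹ i<1+j)) i≢j
    i≢q : i ≢ q
    i≢q = Finₚ.<⇒≢ i<1+j
    N-eq : ∀ r → N r i ≡ N r p
    N-eq r = begin
      N r i                                    ≡⟨ setColumn-off p _ _ r i i≢j ⟩
      setColumn q (λ r → M r p) M r i          ≡⟨ setColumn-off q _ M r i i≢q ⟩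
      M r i                                    ≡⟨ eq r ⟩
      M r q                                    ≡⟨ setColumn-at p _ _ r ⟨
      N r p                                    ∎
    restore : ∀ r c → M r c ≡ setColumn p (λ r → M r p) (setColumn q (λ r → M r q) M) r c
    restore r c = trans (sym (setColumn-self p M r c))
      (setColumn-cong p (λ _ → refl) (λ r c _ → sym (setColumn-self q M r c)) r c)
    alternating : ∀ t → det (setColumn p t (setColumn q t M)) ≡ + 0
    alternating t = det-adjacent-columns j (setColumn p t (setColumn q t M)) λ r →
      trans (setColumn-at p t _ r)
        (sym (trans (setColumn-off p t _ r q (inject₁≢suc j ∘ sym)) (setColumn-at q t M r)))

det-equal-columns : ∀ (M : Matrix n) i j → i ≢ j → (∀ r → M r i ≡ M r j) → det M ≡ + 0
det-equal-columns {suc n} M i j i≢j eq with Finₚ.<-cmp i j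
... | tri< i<j _ _ = det-equal-columns-< j M i i<j eq
... | tri≈ _ i≡j _ = contradiction i≡j i≢j
... | tri> _ _ j<i = det-equal-columns-< i M j j<i (sym ∘ eq)

-- Inner products and Cramer's rule

⟨_,_⟩ : Vector n → Vector n → ℤ
⟨ f , g ⟩ = sumℤ (λ i → f i * g i)

inner-comm : ∀ (f g : Vector n) → ⟨ f , g ⟩ ≡ ⟨ g , f ⟩
inner-comm f g = sum-cong λ i → ℤₚ.*-comm (f i) (g i)

inner-congʳ : ∀ (h : Vector n) {f g} → (∀ i → f i ≡ g i) → ⟨ h , f ⟩ ≡ ⟨ h , g ⟩
inner-congʳ h f≡g = sum-cong λ i → cong (h i *_) (f≡g i)

inner-zeroʳ : ∀ (h : Vector n) {f} → (∀ i → f i ≡ + 0) → ⟨ h , f ⟩ ≡ + 0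
inner-zeroʳ h f≡0 = sum-zero λ i → trans (cong (h i *_) (f≡0 i)) (ℤₚ.*-zeroʳ (h i))

inner-linearʳ : ∀ s (h f g : Vector n) → ⟨ h , (λ i → s * f i +ℤ g i) ⟩ ≡ s * ⟨ h , f ⟩ +ℤ ⟨ h , g ⟩
inner-linearʳ s h f g =
  trans (sum-cong (λ i → distribute (h i) s (f i) (g i)))
        (sum-linear s (λ i → h i * f i) (λ i → h i * g i))
  where
  distribute : ∀ m s a b → m * (s * a +ℤ b) ≡ s * (m * a) +ℤ m * b
  distribute = solve-∀

infixr 8 _·_

_·_ : Matrix n → Vector n → Vector n
(M · y) r = ⟨ M r , y ⟩

det-replace-by-column : ∀ (M : Matrix n) j c → c ≢ j → det (setColumn j (λ r → M r c) M) ≡ + 0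
det-replace-by-column M j c c≢j =
  det-equal-columns _ c j c≢j λ r →
    trans (setColumn-off j _ M r c c≢j) (sym (setColumn-at j _ M r))

det-replace-by-self : ∀ (M : Matrix n) j → det (setColumn j (λ r → M r j) M) ≡ det M
det-replace-by-self M j = det-cong (setColumn-self j M)

-- M y is the combination of the columns of M with coefficients y. Put in place of column j, every
-- summand but the j-th repeats a column that is already present.
cramer : ∀ (M : Matrix n) j (y : Vector n) → y j * det M ≡ det (setColumn j (M · y) M)
cramer M j y = begin
  y j * det M
    ≡⟨ cong (y j *_) (det-replace-by-self M j) ⟨
  y j * det (setColumn j (λ r → M r j) M)
    ≡⟨ sum-single j (λ c → y c * det (setColumn j (λ r → M r c) M))
         (λ c c≢j → trans (cong (y c *_) (det-replace-by-column M j c c≢j)) (ℤₚ.*-zeroʳ (y c))) ⟨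
  sumℤ (λ c → y c * det (setColumn j (λ r → M r c) M))
    ≡⟨ det-setColumn-sum j y (λ c r → M r c) M ⟨
  det (setColumn j (λ r → sumℤ (λ c → y c * M r c)) M)
    ≡⟨ det-cong (setColumn-cong j (λ r → sum-cong (λ c → ℤₚ.*-comm (y c) (M r c))) (λ _ _ _ → refl)) ⟩
  det (setColumn j (M · y) M) ∎

-- Cramer's rule with M y = x y: each eigenvector for x extracts one factor x from the determinant,
-- at the price of replacing a column by it.
det-eigenvector : ∀ (M : Matrix n) x j (y : Vector n) → (∀ r → (M · y) r ≡ x * y r) →
  y j * det M ≡ x * det (setColumn j y M)
det-eigenvector M x j y My≡xy = begin
  y j * det M
    ≡⟨ cramer M j y ⟩
  det (setColumn j (M · y) M)
    ≡⟨ det-cong (setColumn-cong j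
         -- A zero summand is added to reach the shape s u + v of `det-setColumn-linear`.
         (λ r → trans (My≡xy r) (sym (ℤₚ.+-identityʳ (x * y r)))) (λ _ _ _ → refl)) ⟩
  det (setColumn j (λ r → x * y r +ℤ + 0) M)
    ≡⟨ det-setColumn-linear x j y (λ _ → + 0) M ⟩
  x * det (setColumn j y M) +ℤ det (setColumn j (λ _ → + 0) M)
    ≡⟨ cong (x * det (setColumn j y M) +ℤ_) (det-setColumn-zero j (λ _ → + 0) M (λ _ → refl)) ⟩
  x * det (setColumn j y M) +ℤ + 0
    ≡⟨ ℤₚ.+-identityʳ _ ⟩
  x * det (setColumn j y M) ∎

-- A vector with j-th coordinate 0 does not see column j. It therefore remains an eigenvector after
-- that column is replaced, so that `det-eigenvector` can be iterated.
setColumn-· : ∀ (M : Matrix n) j (v y : Vector n) → y j ≡ + 0 →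
  ∀ r → (setColumn j v M · y) r ≡ (M · y) r
setColumn-· M j v y yj≡0 r = sum-cong entry
  where
  entry : ∀ c → setColumn j v M r c * y c ≡ M r c * y c
  entry c with c ≟ j
  ... | no _     = refl
  ... | yes refl rewrite yj≡0 = trans (ℤₚ.*-zeroʳ (v r)) (sym (ℤₚ.*-zeroʳ (M r c)))

-- The identity matrix and the matrix x - A

δ-refl : (i : Fin n) → δ i i ≡ + 1
δ-refl i with i ≟ i
... | yes _  = refl
... | no i≢i = contradiction refl i≢i

δ-off : {i j : Fin n} → i ≢ j → δ i j ≡ + 0
δ-off {i = i} {j} i≢j with i ≟ j
... | yes i≡j = contradiction i≡j i≢j
... | no _    = refl

δ-sym : (i j : Fin n) → δ i j ≡ δ j i
δ-sym i j with i ≟ j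
... | yes refl = sym (δ-refl i)
... | no i≢j   = sym (δ-off (i≢j ∘ sym))

δ-suc : (i j : Fin n) → δ (suc i) (suc j) ≡ δ i j
δ-suc i j with i ≟ j
... | yes _ = refl
... | no _  = refl

sum-δ : ∀ i (f : Vector n) → sumℤ (λ j → δ i j * f j) ≡ f i
sum-δ i f = begin
  sumℤ (λ j → δ i j * f j)  ≡⟨ sum-single i _ (λ j j≢i →
                                 trans (cong (_* f j) (δ-off (j≢i ∘ sym))) (ℤₚ.*-zeroˡ (f j))) ⟩
  δ i i * f i               ≡⟨ cong (_* f i) (δ-refl i) ⟩
  + 1 * f i                 ≡⟨ ℤₚ.*-identityˡ (f i) ⟩
  f i                       ∎

charMatrix : Matrix n → ℤ → Matrix n
charMatrix A x i j = x * δ i j - A i j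

charMatrix-· : ∀ (A : Matrix n) x z r → (charMatrix A x · z) r ≡ x * z r - (A · z) r
charMatrix-· A x z r = begin
  sumℤ (λ c → (x * δ r c - A r c) * z c)
    ≡⟨ sum-cong (λ c → distribute x (δ r c) (A r c) (z c)) ⟩
  sumℤ (λ c → x * (δ r c * z c) +ℤ - + 1 * (A r c * z c))
    ≡⟨ sum-linear x (λ c → δ r c * z c) (λ c → - + 1 * (A r c * z c)) ⟩
  x * sumℤ (λ c → δ r c * z c) +ℤ sumℤ (λ c → - + 1 * (A r c * z c))
    ≡⟨ cong₂ (λ a b → x * a +ℤ b) (sum-δ r z) (sum-* (- + 1) (λ c → A r c * z c)) ⟩
  x * z r +ℤ - + 1 * (A · z) r
    ≡⟨ cong (x * z r +ℤ_) (ℤₚ.-1*i≡-i ((A · z) r)) ⟩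
  x * z r - (A · z) r ∎
  where
  distribute : ∀ x d a z → (x * d - a) * z ≡ x * (d * z) +ℤ - + 1 * (a * z)
  distribute = solve-∀

-- The witness is the j-th row of the adjugate.
det-multiple-in-image : ∀ (M : Matrix n) → (∀ r c → M r c ≡ M c r) → ∀ j →
  Σ[ w ∈ Vector n ] (∀ c → (M · w) c ≡ det M * δ j c)
det-multiple-in-image {n} M M-sym j = w , λ c → begin
  sumℤ (λ i → M c i * w i)
    ≡⟨ sum-cong (λ i → cong (_* w i) (M-sym c i)) ⟩
  sumℤ (λ i → M i c * w i)
    ≡⟨ det-setColumn-sum j (λ i → M i c) δ M ⟨
  det (setColumn j (λ r → sumℤ (λ i → M i c * δ i r)) M)
    ≡⟨ det-cong (setColumn-cong j (λ r → trans (sum-cong (λ i →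
         trans (ℤₚ.*-comm (M i c) (δ i r)) (cong (_* M i c) (δ-sym i r)))) (sum-δ r (λ i → M i c)))
         (λ _ _ _ → refl)) ⟩
  det (setColumn j (λ r → M r c) M)
    ≡⟨ column c ⟩
  det M * δ j c ∎
  where
  w : Vector n
  w i = det (setColumn j (δ i) M)
  column : ∀ c → det (setColumn j (λ r → M r c) M) ≡ det M * δ j c
  column c with j ≟ c
  ... | yes refl = trans (det-replace-by-self M j) (sym (ℤₚ.*-identityʳ (det M)))
  ... | no j≢c   = trans (det-replace-by-column M j c (j≢c ∘ sym)) (sym (ℤₚ.*-zeroʳ (det M)))

-- Definiteness and norms

square-nonneg : ∀ i → + 0 ℤ.≤ i * i
square-nonneg (+ i)    = subst (+ 0 ℤ.≤_) (ℤₚ.pos-* i i) (+≤+ z≤n)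
square-nonneg -[1+ i ] = +≤+ z≤n

i²≡0⇒i≡0 : ∀ i → i * i ≡ + 0 → i ≡ + 0
i²≡0⇒i≡0 i i²≡0 with ℤₚ.i*j≡0⇒i≡0∨j≡0 i i²≡0
... | inj₁ i≡0 = i≡0
... | inj₂ i≡0 = i≡0

sum-nonneg-zero : ∀ {f : Vector n} → (∀ i → + 0 ℤ.≤ f i) → sumℤ f ≡ + 0 → ∀ i → f i ≡ + 0
sum-nonneg-zero {suc n} {f} f≥0 Σf≡0 i = go i
  where
  head≡0 : f zero ≡ + 0
  head≡0 = ℤₚ.≤-antisym
    (subst (f zero ℤ.≤_) Σf≡0
      (subst (ℤ._≤ sumℤ f) (ℤₚ.+-identityʳ (f zero))
        (ℤₚ.+-monoʳ-≤ (f zero) (sum-nonneg (f≥0 ∘ suc)))))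
    (f≥0 zero)
  tail≡0 : sumℤ (f ∘ suc) ≡ + 0
  tail≡0 = trans (sym (ℤₚ.+-identityˡ _)) (trans (cong (_+ℤ sumℤ (f ∘ suc)) (sym head≡0)) Σf≡0)
  go : ∀ i → f i ≡ + 0
  go zero    = head≡0
  go (suc i) = sum-nonneg-zero (f≥0 ∘ suc) tail≡0 i

inner-definite : ∀ (f : Vector n) → ⟨ f , f ⟩ ≡ + 0 → ∀ i → f i ≡ + 0
inner-definite f ff≡0 i =
  i²≡0⇒i≡0 (f i) (sum-nonneg-zero (λ i → square-nonneg (f i)) ff≡0 i)

·-self-adjoint : ∀ (A : Matrix n) → (∀ i j → A i j ≡ A j i) → ∀ f g → ⟨ f , A · g ⟩ ≡ ⟨ A · f , g ⟩
·-self-adjoint A A-sym f g = begin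
  sumℤ (λ i → f i * sumℤ (λ j → A i j * g j))
    ≡⟨ sum-cong (λ i → sum-* (f i) (λ j → A i j * g j)) ⟨
  sumℤ (λ i → sumℤ (λ j → f i * (A i j * g j)))
    ≡⟨ sum-swap (λ i j → f i * (A i j * g j)) ⟩
  sumℤ (λ j → sumℤ (λ i → f i * (A i j * g j)))
    ≡⟨ sum-cong (λ j → sum-cong (λ i →
         trans (cong (λ a → f i * (a * g j)) (A-sym i j)) (rotate (f i) (A j i) (g j)))) ⟩
  sumℤ (λ j → sumℤ (λ i → g j * (A j i * f i)))
    ≡⟨ sum-cong (λ j → trans (sum-* (g j) (λ i → A j i * f i)) (ℤₚ.*-comm (g j) _)) ⟩
  sumℤ (λ j → sumℤ (λ i → A j i * f i) * g j) ∎
  where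
  rotate : ∀ f a g → f * (a * g) ≡ g * (a * f)
  rotate = solve-∀

norm : Vector n → ℤ
norm f = sumℤ (λ i → + ∣ f i ∣)

abs-+ : ∀ i j → + ∣ i +ℤ j ∣ ℤ.≤ + ∣ i ∣ +ℤ + ∣ j ∣
abs-+ i j = +≤+ (ℤₚ.∣i+j∣≤∣i∣+∣j∣ i j)

abs-sum : ∀ (f : Vector n) → + ∣ sumℤ f ∣ ℤ.≤ norm f
abs-sum {zero}  f = ℤₚ.≤-refl
abs-sum {suc n} f = ℤₚ.≤-trans (abs-+ (f zero) (sumℤ (f ∘ suc)))
  (ℤₚ.+-monoʳ-≤ (+ ∣ f zero ∣) (abs-sum (f ∘ suc)))

norm-nonneg : ∀ (f : Vector n) → + 0 ℤ.≤ norm f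
norm-nonneg f = sum-nonneg {f = λ i → + ∣ f i ∣} (λ i → +≤+ z≤n)

norm≡0⇒zero : ∀ (f : Vector n) → norm f ≡ + 0 → ∀ i → f i ≡ + 0
norm≡0⇒zero f ∥f∥≡0 i =
  ℤₚ.∣i∣≡0⇒i≡0 (ℤₚ.+-injective (sum-nonneg-zero {f = λ i → + ∣ f i ∣} (λ _ → +≤+ z≤n) ∥f∥≡0 i))

-- With entries of absolute value at most 1, each of the n coordinates of A f is bounded by the norm
-- of f.
norm-· : ∀ (A : Matrix n) → (∀ i j → ∣ A i j ∣ ≤ 1) → ∀ f → norm (A · f) ℤ.≤ + n * norm f
norm-· {n} A ∣A∣≤1 f =
  subst (norm (A · f) ℤ.≤_) (sum-const n (norm f)) (sum-mono row)
  where
  entry : ∀ i j → + ∣ A i j * f j ∣ ℤ.≤ + ∣ f j ∣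
  entry i j = +≤+ (ℕₚ.≤-trans (ℕₚ.≤-reflexive (ℤₚ.abs-* (A i j) (f j)))
    (ℕₚ.≤-trans (ℕₚ.*-monoˡ-≤ ∣ f j ∣ (∣A∣≤1 i j)) (ℕₚ.≤-reflexive (ℕₚ.*-identityˡ ∣ f j ∣))))
  row : ∀ i → + ∣ (A · f) i ∣ ℤ.≤ norm f
  row i = ℤₚ.≤-trans (abs-sum (λ j → A i j * f j)) (sum-mono (entry i))

-- Images of x - A and the Cayley-Hamilton theorem

Image : Matrix n → ℤ → Vector n → Set
Image {n} A x f = Σ[ z ∈ Vector n ] (∀ i → f i ≡ x * z i - (A · z) i)

-- For x > n + ‖f‖ the equation x z = f + A z forces ‖z‖ < 1.
in-every-image⇒zero : ∀ (A : Matrix n) → (∀ i j → ∣ A i j ∣ ≤ 1) →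
  ∀ f → (∀ x → Image A x f) → ∀ i → f i ≡ + 0
in-every-image⇒zero {n} A ∣A∣≤1 f image i with image (+ (suc ∣ norm f ∣ + n))
... | z , f≡ = begin
  f i                    ≡⟨ f≡ i ⟩
  x * z i - (A · z) i    ≡⟨ cong₂ _-_ (cong (x *_) (z≡0 i)) (inner-zeroʳ (A i) z≡0) ⟩
  x * + 0 - + 0          ≡⟨ cong (_- + 0) (ℤₚ.*-zeroʳ x) ⟩
  + 0                    ∎
  where
  Y S : ℕ
  Y = ∣ norm f ∣
  S = ∣ norm z ∣
  x : ℤ
  x = + (suc Y + n)
  solved : ∀ i → x * z i ≡ f i +ℤ (A · z) i
  solved i = trans (add-back (x * z i) ((A · z) i)) (cong (_+ℤ (A · z) i) (sym (f≡ i)))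
    where
    add-back : ∀ a b → a ≡ a - b +ℤ b
    add-back = solve-∀
  bound : ∀ i → x * + ∣ z i ∣ ℤ.≤ + ∣ f i ∣ +ℤ + ∣ (A · z) i ∣
  bound i = subst (ℤ._≤ + ∣ f i ∣ +ℤ + ∣ (A · z) i ∣)
    (trans (cong (λ t → + ∣ t ∣) (sym (solved i)))
      (trans (cong +_ (ℤₚ.abs-* x (z i))) (ℤₚ.pos-* (suc Y + n) ∣ z i ∣)))
    (abs-+ (f i) ((A · z) i))
  Y≡ : norm f ≡ + Y
  Y≡ = sym (ℤₚ.0≤i⇒+∣i∣≡i (norm-nonneg f))
  S≡ : norm z ≡ + S
  S≡ = sym (ℤₚ.0≤i⇒+∣i∣≡i (norm-nonneg z))
  summed : x * norm z ℤ.≤ norm f +ℤ + n * norm z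
  summed = ℤₚ.≤-trans
    (ℤₚ.≤-trans (ℤₚ.≤-reflexive (sym (sum-* x (λ i → + ∣ z i ∣)))) (sum-mono bound))
    (ℤₚ.≤-trans (ℤₚ.≤-reflexive (sum-+ (λ i → + ∣ f i ∣) (λ i → + ∣ (A · z) i ∣)))
      (ℤₚ.+-monoʳ-≤ (norm f) (norm-· A ∣A∣≤1 z)))
  summedℕ : (suc Y + n) ℕ.* S ≤ Y + n ℕ.* S
  summedℕ = ℤₚ.drop‿+≤+ (subst (ℤ._≤ + (Y + n ℕ.* S)) (sym (ℤₚ.pos-* (suc Y + n) S))
    (subst (x * + S ℤ.≤_)
      (trans (cong (+ Y +ℤ_) (sym (ℤₚ.pos-* n S))) (sym (ℤₚ.pos-+ Y (n ℕ.* S))))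
      (subst₂ (λ s y → x * s ℤ.≤ y +ℤ + n * s) S≡ Y≡ summed)))
  -- Cancelling n s leaves (Y + 1) s ≤ Y. Since z is an integer vector, its norm s is a natural
  -- number, and so it is 0.
  small : ∀ s → (suc Y + n) ℕ.* s ≤ Y + n ℕ.* s → s ≡ 0
  small zero    _ = refl
  small (suc s) p = contradiction
    (ℕₚ.≤-trans (ℕₚ.m≤m*n (suc Y) (suc s))
      (ℕₚ.+-cancelʳ-≤ (n ℕ.* suc s) _ _
        (subst (_≤ Y + n ℕ.* suc s) (ℕₚ.*-distribʳ-+ (suc s) (suc Y) n) p)))
    ℕₚ.1+n≰n
  z≡0 : ∀ i → z i ≡ + 0
  z≡0 = norm≡0⇒zero z (trans S≡ (cong +_ (small S summedℕ)))

Image-cong : ∀ (A : Matrix n) x {f g} → (∀ i → f i ≡ g i) → Image A x f → Image A x g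
Image-cong A x f≡g (z , f≡) = z , λ i → trans (sym (f≡g i)) (f≡ i)

module _ (A : Matrix n) (κ : ℤ) where

  D : Vector n → Vector n
  D f i = (A · A · f) i - κ * f i

  D^ : ℕ → Vector n → Vector n
  D^ zero    f = f
  D^ (suc N) f = D (D^ N f)

  -- Modulo the image of x − A, the operator A acts as the scalar x.
  Image-A : ∀ x s g → Image A x (λ i → s * x * g i) → Image A x (λ i → s * (A · g) i)
  Image-A x s g (z , eq) = z′ , λ i → begin
    s * (A · g) i
      ≡⟨ algebra s x (g i) ((A · g) i) (z i) ((A · z) i) (eq i) ⟩
    x * z′ i - (- s * (A · g) i +ℤ (A · z) i)
      ≡⟨ cong (λ t → x * z′ i - t) (inner-linearʳ (- s) (A i) g z) ⟨
    x * z′ i - (A · z′) i ∎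
    where
    z′ : Vector n
    -- From s A g = s x g - (x - A)(s g), the preimage changes by -s g.
    z′ i = - s * g i +ℤ z i
    identity : ∀ s x g Ag z Az →
      s * Ag ≡ x * (- s * g +ℤ z) - (- s * Ag +ℤ Az) +ℤ (s * x * g - (x * z - Az))
    identity = solve-∀
    algebra : ∀ s x g Ag z Az → s * x * g ≡ x * z - Az →
      s * Ag ≡ x * (- s * g +ℤ z) - (- s * Ag +ℤ Az)
    algebra s x g Ag z Az eq = trans (identity s x g Ag z Az)
      (trans (cong (x * (- s * g +ℤ z) - (- s * Ag +ℤ Az) +ℤ_) (ℤₚ.i≡j⇒i-j≡0 eq)) (ℤₚ.+-identityʳ _))

  -- The scalar x² - κ and the operator `D` differ by x² - A² = (x - A)(x + A), so the preimage
  -- changes by -s (x g + A g).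
  Image-D : ∀ x s g → Image A x (λ i → s * (x * x - κ) * g i) → Image A x (λ i → s * D g i)
  Image-D x s g (z , eq) = z′ , λ i → begin
    s * D g i
      ≡⟨ algebra s x κ (g i) ((A · g) i) ((A · A · g) i) (z i) ((A · z) i) (eq i) ⟩
    x * z′ i - (- s * (x * (A · g) i +ℤ (A · A · g) i) +ℤ (A · z) i)
      ≡⟨ cong (λ t → x * z′ i - t) (trans (inner-linearʳ (- s) (A i) h z)
           (cong (λ t → - s * t +ℤ (A · z) i) (inner-linearʳ x (A i) g (A · g)))) ⟨
    x * z′ i - (A · z′) i ∎
    where
    h z′ : Vector n
    h i  = x * g i +ℤ (A · g) i
    z′ i = - s * h i +ℤ z i
    identity : ∀ s x κ g Ag AAg z Az →
      s * (AAg - κ * g) ≡ x * (- s * (x * g +ℤ Ag) +ℤ z) - (- s * (x * Ag +ℤ AAg) +ℤ Az)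
                            +ℤ (s * (x * x - κ) * g - (x * z - Az))
    identity = solve-∀
    algebra : ∀ s x κ g Ag AAg z Az → s * (x * x - κ) * g ≡ x * z - Az →
      s * (AAg - κ * g) ≡ x * (- s * (x * g +ℤ Ag) +ℤ z) - (- s * (x * Ag +ℤ AAg) +ℤ Az)
    algebra s x κ g Ag AAg z Az eq = trans (identity s x κ g Ag AAg z Az)
      (trans (cong (x * (- s * (x * g +ℤ Ag) +ℤ z) - (- s * (x * Ag +ℤ AAg) +ℤ Az) +ℤ_)
                   (ℤₚ.i≡j⇒i-j≡0 eq)) (ℤₚ.+-identityʳ _))

  -- The free scalar s makes the induction work: it absorbs one factor x² - κ, which `Image-D` then
  -- turns into a `D`.
  Image-D^ : ∀ x N s g → Image A x (λ i → s * (((x * x - κ) ^ℤ N) * g i)) →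
    Image A x (λ i → s * D^ N g i)
  Image-D^ x zero    s g im = Image-cong A x (λ i → cong (s *_) (ℤₚ.*-identityˡ (g i))) im
  Image-D^ x (suc N) s g im = Image-D x s (D^ N g) (Image-D^ x N (s * X) g
    (Image-cong A x (λ i → regroup s X (X ^ℤ N) (g i)) im))
    where
    X = x * x - κ
    regroup : ∀ s X Y g → s * (X * Y * g) ≡ s * X * (Y * g)
    regroup = solve-∀

  -- The conclusion is p(A) e_j = 0 for the polynomial p(x) = x² (x² - κ)^N. The adjugate places
  -- p(x) e_j in the image of x - A, and modulo that image p(x) may be exchanged for p(A).
  cayley-hamilton : (∀ i j → A i j ≡ A j i) → (∀ i j → ∣ A i j ∣ ≤ 1) → ∀ N →
    (∀ x → det (charMatrix A x) ≡ (x ^ℤ 2) * ((x * x - κ) ^ℤ N)) →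
    ∀ j i → (A · A · D^ N (δ j)) i ≡ + 0
  cayley-hamilton A-sym ∣A∣≤1 N char j = in-every-image⇒zero A ∣A∣≤1 _ image
    where
    charMatrix-sym : ∀ x r c → charMatrix A x r c ≡ charMatrix A x c r
    charMatrix-sym x r c = cong₂ (λ d a → x * d - a) (δ-sym r c) (A-sym r c)
    rearrange : ∀ x X d → x * (x * + 1) * X * d ≡ x * x * (X * d)
    rearrange = solve-∀
    image : ∀ x → Image A x (A · A · D^ N (δ j))
    image x with det-multiple-in-image (charMatrix A x) (charMatrix-sym x) j
    ... | w , eq =
      -- Read from the inside: `start` places x² (x² - κ)^N e_j in the image, `Image-D^` trades the
      -- powers of x² - κ for `D^ N`, and two uses of `Image-A` trade each x for A.
      Image-cong A x (λ i → ℤₚ.*-identityˡ _)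
        (Image-A x (+ 1) (A · D^ N (δ j))
          (Image-cong A x (λ i → cong (_* (A · D^ N (δ j)) i) (sym (ℤₚ.*-identityˡ x)))
            (Image-A x x (D^ N (δ j)) (Image-D^ x N (x * x) (δ j) (w , start)))))
      where
      start : ∀ i → x * x * (((x * x - κ) ^ℤ N) * δ j i) ≡ x * w i - (A · w) i
      start i = begin
        x * x * (((x * x - κ) ^ℤ N) * δ j i)   ≡⟨ rearrange x ((x * x - κ) ^ℤ N) (δ j i) ⟨
        (x ^ℤ 2) * ((x * x - κ) ^ℤ N) * δ j i  ≡⟨ cong (_* δ j i) (char x) ⟨
        det (charMatrix A x) * δ j i           ≡⟨ eq i ⟨
        (charMatrix A x · w) i                 ≡⟨ charMatrix-· A x w i ⟩
        x * w i - (A · w) i                    ∎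

  D-zero : ∀ {f} → (∀ i → f i ≡ + 0) → ∀ i → D f i ≡ + 0
  D-zero {f} f≡0 i = begin
    (A · A · f) i - κ * f i
      ≡⟨ cong₂ (λ a b → a - κ * b) (inner-zeroʳ (A i) (λ j → inner-zeroʳ (A j) f≡0)) (f≡0 i) ⟩
    + 0 - κ * + 0
      ≡⟨ cong (λ t → + 0 - t) (ℤₚ.*-zeroʳ κ) ⟩
    + 0 ∎

  inner-Dʳ : ∀ h f → ⟨ h , D f ⟩ ≡ ⟨ h , A · A · f ⟩ - κ * ⟨ h , f ⟩
  inner-Dʳ h f = begin
    ⟨ h , D f ⟩
      ≡⟨ inner-congʳ h (λ i → reorder κ ((A · A · f) i) (f i)) ⟩
    ⟨ h , (λ i → - κ * f i +ℤ (A · A · f) i) ⟩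
      ≡⟨ inner-linearʳ (- κ) h f (A · A · f) ⟩
    - κ * ⟨ h , f ⟩ +ℤ ⟨ h , A · A · f ⟩
      ≡⟨ reorder κ ⟨ h , A · A · f ⟩ ⟨ h , f ⟩ ⟨
    ⟨ h , A · A · f ⟩ - κ * ⟨ h , f ⟩ ∎
    where
    reorder : ∀ κ a b → a - κ * b ≡ - κ * b +ℤ a
    reorder = solve-∀

  A-D-comm : ∀ f i → (A · D f) i ≡ D (A · f) i
  A-D-comm f i = inner-Dʳ (A i) f

  module _ (A-sym : ∀ i j → A i j ≡ A j i) where

    D-self-adjoint : ∀ f g → ⟨ f , D g ⟩ ≡ ⟨ D f , g ⟩
    D-self-adjoint f g = begin
      ⟨ f , D g ⟩                             ≡⟨ inner-Dʳ f g ⟩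
      ⟨ f , A · A · g ⟩ - κ * ⟨ f , g ⟩       ≡⟨ cong₂ (λ a b → a - κ * b) twice (inner-comm f g) ⟩
      ⟨ g , A · A · f ⟩ - κ * ⟨ g , f ⟩       ≡⟨ inner-Dʳ g f ⟨
      ⟨ g , D f ⟩                             ≡⟨ inner-comm g (D f) ⟩
      ⟨ D f , g ⟩                             ∎
      where
      twice : ⟨ f , A · A · g ⟩ ≡ ⟨ g , A · A · f ⟩
      twice = begin
        ⟨ f , A · A · g ⟩    ≡⟨ ·-self-adjoint A A-sym f (A · g) ⟩
        ⟨ A · f , A · g ⟩    ≡⟨ ·-self-adjoint A A-sym (A · f) g ⟩
        ⟨ A · A · f , g ⟩    ≡⟨ inner-comm (A · A · f) g ⟩
        ⟨ g , A · A · f ⟩    ∎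

    -- The squared norm of A f is ⟨f, A² f⟩ = 0.
    kernel-A² : ∀ f → (∀ i → (A · A · f) i ≡ + 0) → ∀ i → (A · f) i ≡ + 0
    kernel-A² f AAf≡0 = inner-definite (A · f)
      (trans (sym (·-self-adjoint A A-sym f (A · f))) (inner-zeroʳ f AAf≡0))

    -- As `D` is self-adjoint and commutes with A, the squared norm of A D f equals ⟨A f, A D² f⟩ =
    -- 0.
    kernel-AD² : ∀ f → (∀ i → (A · D (D f)) i ≡ + 0) → ∀ i → (A · D f) i ≡ + 0
    kernel-AD² f ADDf≡0 = inner-definite (A · D f) (begin
      ⟨ A · D f , A · D f ⟩
        ≡⟨ inner-congʳ (A · D f) (A-D-comm f) ⟩
      ⟨ A · D f , D (A · f) ⟩
        ≡⟨ D-self-adjoint (A · D f) (A · f) ⟩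
      ⟨ D (A · D f) , A · f ⟩
        ≡⟨ inner-comm (D (A · D f)) (A · f) ⟩
      ⟨ A · f , D (A · D f) ⟩
        ≡⟨ inner-zeroʳ (A · f) (λ i → trans (sym (A-D-comm (D f) i)) (ADDf≡0 i)) ⟩
      + 0 ∎)

    -- Symmetric matrices are semisimple, so the polynomial x² (x² − κ)^N may be replaced by its radical.
    kernel-AD^ : ∀ N f → (∀ i → (A · D^ N f) i ≡ + 0) → ∀ i → (A · D f) i ≡ + 0
    -- Here A f = 0 already, and A D f = D A f.
    kernel-AD^ zero          f eq i = trans (A-D-comm f i) (D-zero eq i)
    kernel-AD^ (suc zero)    f eq   = eq
    kernel-AD^ (suc (suc N)) f eq   = kernel-AD^ (suc N) f (kernel-AD² (D^ N f) eq)

-- The null space of A is at most two-dimensional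

divisible-by-all⇒zero : ∀ z → (∀ m → Σ[ t ∈ ℤ ] (z ≡ + suc m * t)) → z ≡ + 0
divisible-by-all⇒zero z divisible with divisible ∣ z ∣
-- The chosen divisor ∣z∣ + 1 exceeds ∣z∣, so the cofactor must be 0.
... | t , z≡ = ℤₚ.∣i∣≡0⇒i≡0 (small ∣ z ∣ ∣ t ∣ (trans (cong ∣_∣ z≡) (ℤₚ.abs-* (+ suc ∣ z ∣) t)))
  where
  small : ∀ a b → a ≡ suc a ℕ.* b → a ≡ 0
  small a zero    eq = trans eq (ℕₚ.*-zeroʳ a)
  small a (suc b) eq = contradiction (ℕₚ.≤-trans (ℕₚ.m≤m*n (suc a) (suc b)) (ℕₚ.≤-reflexive (sym eq))) ℕₚ.1+n≰n

-- Modulo x the power is the constant (-κ)^N. This converts divisibility by x of a quantity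
-- depending on x into divisibility of one fixed integer.
^-mod : ∀ x κ N → Σ[ s ∈ ℤ ] ((x * x - κ) ^ℤ N ≡ x * s +ℤ (- κ) ^ℤ N)
^-mod x κ zero = + 0 , cong (_+ℤ + 1) (sym (ℤₚ.*-zeroʳ x))
^-mod x κ (suc N) with ^-mod x κ N
... | s , eq = x * (x * s +ℤ (- κ) ^ℤ N) - κ * s ,
  trans (cong ((x * x - κ) *_) eq) (expand x κ s ((- κ) ^ℤ N))
  where
  expand : ∀ x κ s p → (x * x - κ) * (x * s +ℤ p) ≡ x * (x * (x * s +ℤ p) - κ * s) +ℤ - κ * p
  expand = solve-∀

^-nonzero : ∀ z N → z ≢ + 0 → z ^ℤ N ≢ + 0
^-nonzero z (suc N) z≢0 eq with ℤₚ.i*j≡0⇒i≡0∨j≡0 z eq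
... | inj₁ z≡0 = z≢0 z≡0
... | inj₂ p≡0 = ^-nonzero z N z≢0 p≡0

charMatrix-null : ∀ (A : Matrix n) x y → (∀ r → (A · y) r ≡ + 0) → ∀ r → (charMatrix A x · y) r ≡ x * y r
charMatrix-null A x y Ay≡0 r = trans (charMatrix-· A x y r)
  (trans (cong (λ t → x * y r - t) (Ay≡0 r)) (ℤₚ.+-identityʳ (x * y r)))

-- Three independent null vectors would make x³ divide a multiple of det (x − A).
third-null-vector-zero : ∀ (A : Matrix n) κ N → κ ≢ + 0 →
  (∀ x → det (charMatrix A x) ≡ (x ^ℤ 2) * ((x * x - κ) ^ℤ N)) →
  ∀ (a b c : Vector n) →
  (∀ r → (A · a) r ≡ + 0) → (∀ r → (A · b) r ≡ + 0) → (∀ r → (A · c) r ≡ + 0) →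
  ∀ {u v} → a u ≡ + 1 → b u ≡ + 0 → b v ≡ + 1 → c u ≡ + 0 → c v ≡ + 0 →
  ∀ w → c w ≡ + 0
third-null-vector-zero {n} A κ N κ≢0 char a b c Aa≡0 Ab≡0 Ac≡0 {u} {v} au bu bv cu cv w
  = conclude (ℤₚ.i*j≡0⇒i≡0∨j≡0 (c w) (divisible-by-all⇒zero (c w * (- κ) ^ℤ N) multiple))
  where
  conclude : c w ≡ + 0 ⊎ (- κ) ^ℤ N ≡ + 0 → c w ≡ + 0
  conclude (inj₁ cw≡0)  = cw≡0
  conclude (inj₂ κ^N≡0) = contradiction κ^N≡0
    (^-nonzero (- κ) N (λ -κ≡0 → κ≢0 (trans (sym (ℤₚ.neg-involutive κ)) (cong -_ -κ≡0))))
  multiple : ∀ m → Σ[ t ∈ ℤ ] (c w * (- κ) ^ℤ N ≡ + suc m * t)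
  -- Cancelling x² leaves c_w (x s + (-κ)^N) = x det M₃; solving for c_w (-κ)^N gives this cofactor.
  multiple m = det M₃ - c w * s ,
    reduce x (c w) s ((- κ) ^ℤ N) (det M₃)
      (trans (cong (c w *_) (sym power)) (ℤₚ.*-cancelˡ-≡ (x * x) (c w * X) (x * det M₃) cubed))
    where
    x X s : ℤ
    -- A positive x, so that x² can be cancelled.
    x = + suc m
    X = (x * x - κ) ^ℤ N
    s = proj₁ (^-mod x κ N)
    power : X ≡ x * s +ℤ (- κ) ^ℤ N
    power = proj₂ (^-mod x κ N)
    -- The null vectors a, b, c enter at columns u, v, w in turn, each extracting a factor x. The
    -- zeros of b at u and of c at u and v keep them eigenvectors of the altered matrices.
    M M₁ M₂ M₃ : Matrix n
    M  = charMatrix A x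
    M₁ = setColumn u a M
    M₂ = setColumn v b M₁
    M₃ = setColumn w c M₂
    step₁ : + 1 * det M ≡ x * det M₁
    step₁ = trans (cong (_* det M) (sym au)) (det-eigenvector M x u a (charMatrix-null A x a Aa≡0))
    step₂ : + 1 * det M₁ ≡ x * det M₂
    step₂ = trans (cong (_* det M₁) (sym bv)) (det-eigenvector M₁ x v b
      (λ r → trans (setColumn-· M u a b bu r) (charMatrix-null A x b Ab≡0 r)))
    step₃ : c w * det M₂ ≡ x * det M₃
    step₃ = det-eigenvector M₂ x w c
      (λ r → trans (setColumn-· M₁ v b c cv r)
        (trans (setColumn-· M u a c cu r) (charMatrix-null A x c Ac≡0 r)))
    collect₁ : ∀ x c X → x * x * (c * X) ≡ c * (+ 1 * (x * (x * + 1) * X))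
    collect₁ = solve-∀
    collect₂ : ∀ c x d → c * (x * (+ 1 * d)) ≡ x * (c * (+ 1 * d))
    collect₂ = solve-∀
    collect₃ : ∀ x c d → x * (c * (x * d)) ≡ x * x * (c * d)
    collect₃ = solve-∀
    cubed : x * x * (c w * X) ≡ x * x * (x * det M₃)
    cubed = begin
      x * x * (c w * X)                 ≡⟨ collect₁ x (c w) X ⟩
      c w * (+ 1 * ((x ^ℤ 2) * X))      ≡⟨ cong (λ d → c w * (+ 1 * d)) (char x) ⟨
      c w * (+ 1 * det M)               ≡⟨ cong (c w *_) step₁ ⟩
      c w * (x * det M₁)                ≡⟨ cong (λ d → c w * (x * d)) (ℤₚ.*-identityˡ (det M₁)) ⟨
      c w * (x * (+ 1 * det M₁))        ≡⟨ collect₂ (c w) x (det M₁) ⟩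
      x * (c w * (+ 1 * det M₁))        ≡⟨ cong (λ d → x * (c w * d)) step₂ ⟩
      x * (c w * (x * det M₂))          ≡⟨ collect₃ x (c w) (det M₂) ⟩
      x * x * (c w * det M₂)            ≡⟨ cong (x * x *_) step₃ ⟩
      x * x * (x * det M₃)              ∎
    reduce : ∀ x c s p d → c * (x * s +ℤ p) ≡ x * d → c * p ≡ x * (d - c * s)
    reduce x c s p d eq = begin
      c * p                          ≡⟨ isolate x c s p ⟩
      c * (x * s +ℤ p) - x * (c * s) ≡⟨ cong (λ t → t - x * (c * s)) eq ⟩
      x * d - x * (c * s)            ≡⟨ factor x d (c * s) ⟩
      x * (d - c * s)                ∎
      where
      isolate : ∀ x c s p → c * p ≡ c * (x * s +ℤ p) - x * (c * s)
      isolate = solve-∀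
      factor : ∀ x d e → x * d - x * e ≡ x * (d - e)
      factor = solve-∀

-- The scaled projection onto the null space

module _ (A : Matrix n) (κ : ℤ) where

  -- P = κ − A² is κ times the orthogonal projection onto the null space of A.
  P : Matrix n
  P u w = - D A κ (δ u) w

  inner-Pʳ : ∀ f u → ⟨ f , P u ⟩ ≡ - ⟨ f , D A κ (δ u) ⟩
  inner-Pʳ f u = begin
    ⟨ f , P u ⟩
      ≡⟨ sum-cong (λ i → extract (f i) (D A κ (δ u) i)) ⟩
    sumℤ (λ i → - + 1 * (f i * D A κ (δ u) i))
      ≡⟨ sum-* (- + 1) (λ i → f i * D A κ (δ u) i) ⟩
    - + 1 * ⟨ f , D A κ (δ u) ⟩
      ≡⟨ ℤₚ.-1*i≡-i ⟨ f , D A κ (δ u) ⟩ ⟩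
    - ⟨ f , D A κ (δ u) ⟩ ∎
    where
    extract : ∀ f d → f * - d ≡ - + 1 * (f * d)
    extract = solve-∀

  module _ (A-sym : ∀ i j → A i j ≡ A j i) where

    inner-Dδ : ∀ f u → ⟨ f , D A κ (δ u) ⟩ ≡ D A κ f u
    inner-Dδ f u = begin
      ⟨ f , D A κ (δ u) ⟩   ≡⟨ D-self-adjoint A κ A-sym f (δ u) ⟩
      ⟨ D A κ f , δ u ⟩     ≡⟨ inner-comm (D A κ f) (δ u) ⟩
      ⟨ δ u , D A κ f ⟩     ≡⟨ sum-δ u (D A κ f) ⟩
      D A κ f u             ∎

    P-sym : ∀ u w → P u w ≡ P w u
    P-sym u w = cong -_ (trans (sym (sum-δ w (D A κ (δ u)))) (inner-Dδ (δ w) u))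

    -- The diagonal entry of A² is the squared norm of a row, which for a signed graph will be the
    -- degree.
    P-diagonal : ∀ u → P u u ≡ κ - ⟨ A u , A u ⟩
    P-diagonal u = begin
      - (⟨ A u , A · δ u ⟩ - κ * δ u u)
        ≡⟨ cong₂ (λ a d → - (a - κ * d)) (inner-congʳ (A u) column) (δ-refl u) ⟩
      - (⟨ A u , A u ⟩ - κ * + 1)
        ≡⟨ rearrange ⟨ A u , A u ⟩ κ ⟩
      κ - ⟨ A u , A u ⟩ ∎
      where
      rearrange : ∀ a κ → - (a - κ * + 1) ≡ κ - a
      rearrange = solve-∀
      column : ∀ i → (A · δ u) i ≡ A u i
      column i = trans (inner-comm (A i) (δ u)) (trans (sum-δ u (A i)) (A-sym i u))

    -- On null vectors A² - κ acts as -κ. Taking f to be a row of `P` gives P² = κ P.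
    inner-P-null : ∀ f u → (∀ i → (A · f) i ≡ + 0) → ⟨ f , P u ⟩ ≡ κ * f u
    inner-P-null f u Af≡0 = begin
      ⟨ f , P u ⟩                      ≡⟨ inner-Pʳ f u ⟩
      - ⟨ f , D A κ (δ u) ⟩            ≡⟨ cong -_ (inner-Dδ f u) ⟩
      - ((A · A · f) u - κ * f u)      ≡⟨ cong (λ t → - (t - κ * f u)) (inner-zeroʳ (A u) Af≡0) ⟩
      - (+ 0 - κ * f u)                ≡⟨ rearrange (κ * f u) ⟩
      κ * f u                          ∎
      where
      rearrange : ∀ t → - (+ 0 - t) ≡ t
      rearrange = solve-∀

    module _ (∣A∣≤1 : ∀ i j → ∣ A i j ∣ ≤ 1) (N : ℕ)
      (char : ∀ x → det (charMatrix A x) ≡ (x ^ℤ 2) * ((x * x - κ) ^ℤ N)) where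

      -- Cayley-Hamilton gives A² (A² - κ)^N = 0; definiteness then reduces this to A (A² - κ) = 0.
      A·P≡0 : ∀ u i → (A · P u) i ≡ + 0
      A·P≡0 u i = trans (inner-Pʳ (A i) u) (cong -_
        (kernel-AD^ A κ A-sym N (δ u)
          (kernel-A² A κ A-sym (D^ A κ N (δ u)) (cayley-hamilton A κ A-sym ∣A∣≤1 N char u)) i))

      -- Subtracting from the row of w its components along the rows of u and v leaves a null vector
      -- c that vanishes at u and at v. Hence c = 0, and its coordinate at w is the claim.
      P-diagonal-split : κ ≢ + 0 → ∀ {u v} → P u u ≡ + 1 → P v v ≡ + 1 → P u v ≡ + 0 →
        ∀ w → P w w ≡ P u w * P u w +ℤ P v w * P v w
      P-diagonal-split κ≢0 {u} {v} uu vv uv w = begin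
        P w w
          ≡⟨ recover (P w w) (P w u) (P u w) (P w v) (P v w) ⟩
        c w +ℤ (P w u * P u w +ℤ P w v * P v w)
          ≡⟨ cong₂ _+ℤ_
               (third-null-vector-zero A κ N κ≢0 char (P u) (P v) c (A·P≡0 u) (A·P≡0 v) A·c≡0
                 uu vu vv cu cv w)
               (cong₂ (λ p q → p * P u w +ℤ q * P v w) (P-sym w u) (P-sym w v)) ⟩
        + 0 +ℤ (P u w * P u w +ℤ P v w * P v w)
          ≡⟨ ℤₚ.+-identityˡ _ ⟩
        P u w * P u w +ℤ P v w * P v w ∎
        where
        c : Vector n
        c i = - P w u * P u i +ℤ (- P w v * P v i +ℤ P w i)
        vu : P v u ≡ + 0
        vu = trans (P-sym v u) uv
        recover : ∀ t wu uw wv vw → t ≡ - wu * uw +ℤ (- wv * vw +ℤ t) +ℤ (wu * uw +ℤ wv * vw)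
        recover = solve-∀
        A·c≡0 : ∀ i → (A · c) i ≡ + 0
        A·c≡0 i = begin
          (A · c) i
            ≡⟨ inner-linearʳ (- P w u) (A i) (P u) (λ i → - P w v * P v i +ℤ P w i) ⟩
          - P w u * (A · P u) i +ℤ (A · (λ i → - P w v * P v i +ℤ P w i)) i
            ≡⟨ cong₂ (λ s t → - P w u * s +ℤ t) (A·P≡0 u i)
                 (inner-linearʳ (- P w v) (A i) (P v) (P w)) ⟩
          - P w u * + 0 +ℤ (- P w v * (A · P v) i +ℤ (A · P w) i)
            ≡⟨ cong₂ (λ s t → - P w u * + 0 +ℤ (- P w v * s +ℤ t)) (A·P≡0 v i) (A·P≡0 w i) ⟩
          - P w u * + 0 +ℤ (- P w v * + 0 +ℤ + 0)
            ≡⟨ vanish (P w u) (P w v) ⟩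
          + 0 ∎
          where
          vanish : ∀ p q → - p * + 0 +ℤ (- q * + 0 +ℤ + 0) ≡ + 0
          vanish = solve-∀
        cu : c u ≡ + 0
        cu = trans (cong₂ (λ s t → - P w u * s +ℤ (- P w v * t +ℤ P w u)) uu vu)
                   (cancel (P w u) (P w v))
          where
          cancel : ∀ p q → - p * + 1 +ℤ (- q * + 0 +ℤ p) ≡ + 0
          cancel = solve-∀
        cv : c v ≡ + 0
        cv = trans (cong₂ (λ s t → - P w u * s +ℤ (- P w v * t +ℤ P w v)) uv vv)
                   (cancel (P w u) (P w v))
          where
          cancel : ∀ p q → - p * + 0 +ℤ (- q * + 1 +ℤ q) ≡ + 0
          cancel = solve-∀

-- Adding a vertex

extend : SignedGraph n → (Fin n → Entry) → SignedGraph (suc n)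
extend {n} G e = record { adj = adj′ ; symmetric = symmetric′ ; loopless = loopless′ }
  where
  adj′ : Fin (suc n) → Fin (suc n) → Entry
  adj′ zero    zero    = none
  adj′ zero    (suc j) = e j
  adj′ (suc i) zero    = e i
  adj′ (suc i) (suc j) = adj G i j
  symmetric′ : ∀ i j → adj′ i j ≡ adj′ j i
  symmetric′ zero    zero    = refl
  symmetric′ zero    (suc j) = refl
  symmetric′ (suc i) zero    = refl
  symmetric′ (suc i) (suc j) = symmetric G i j
  loopless′ : ∀ i → adj′ i i ≡ none
  loopless′ zero    = refl
  loopless′ (suc i) = loopless G i

det-zero-column : ∀ (M : Matrix n) j → (∀ r → M r j ≡ + 0) → det M ≡ + 0
det-zero-column M j Mj≡0 =
  trans (sym (det-replace-by-self M j)) (det-setColumn-zero j (λ r → M r j) M Mj≡0)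

-- In the expansion along the first row, every minor that keeps the first column has a zero column.
det-block : ∀ (M : Matrix (suc n)) → (∀ r → M (suc r) zero ≡ + 0) →
  det M ≡ M zero zero * det (minor M zero)
det-block {n} M below≡0 =
  trans (sum-single zero (laplaceTerm M) (λ { zero 0≢0 → contradiction refl 0≢0 ; (suc l) _ → vanish M below≡0 l }))
        (ℤₚ.*-identityˡ (M zero zero * det (minor M zero)))
  where
  annihilate : ∀ σ p → σ * (p * + 0) ≡ + 0
  annihilate = solve-∀
  -- The size is quantified anew: the index `suc l` forces a second column, so the minor has a
  -- column `zero`.
  vanish : ∀ {n} (M : Matrix (suc n)) → (∀ r → M (suc r) zero ≡ + 0) → ∀ l → laplaceTerm M (suc l) ≡ + 0
  vanish {suc n} M below≡0 l =
    trans (cong (λ d → sgn (toℕ' (suc l)) * (M zero (suc l) * d))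
                (det-zero-column (minor M (suc l)) zero below≡0))
          (annihilate (sgn (toℕ' (suc l))) (M zero (suc l)))

module _ (G : SignedGraph n) (e : Fin n → Entry) where

  private
    A : Matrix n
    A = adjMatrix G
    B : Matrix (suc n)
    B = adjMatrix (extend G e)
    a : Vector n
    a i = entryℤ (e i)

  -- The vector (x, a) is mapped by x − B to (x² − κ, 0).
  extend-det : ∀ κ → (∀ i → (A · a) i ≡ + 0) → ⟨ a , a ⟩ ≡ κ → ∀ x →
    x * det (charMatrix B x) ≡ (x * x - κ) * det (charMatrix A x)
  extend-det κ Aa≡0 aa≡κ x = begin
    x * det M
      ≡⟨ cramer M zero y ⟩
    det (setColumn zero (M · y) M)
      ≡⟨ det-block (setColumn zero (M · y) M) below ⟩
    (M · y) zero * det (minor M zero)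
      ≡⟨ cong₂ _*_ corner (det-cong (λ i j → cong (λ d → x * d - A i j) (δ-suc i j))) ⟩
    (x * x - κ) * det (charMatrix A x) ∎
    where
    M : Matrix (suc n)
    M = charMatrix B x
    y : Vector (suc n)
    y zero    = x
    y (suc i) = a i
    corner : (M · y) zero ≡ x * x - κ
    corner = trans (charMatrix-· B x y zero)
      (cong (λ t → x * x - t) (trans (cong (_+ℤ ⟨ a , a ⟩) (ℤₚ.*-zeroˡ x))
                                     (trans (ℤₚ.+-identityˡ ⟨ a , a ⟩) aa≡κ)))
    below : ∀ i → (M · y) (suc i) ≡ + 0
    below i = begin
      (M · y) (suc i)                       ≡⟨ charMatrix-· B x y (suc i) ⟩
      x * a i - (a i * x +ℤ (A · a) i)      ≡⟨ cong (λ t → x * a i - (a i * x +ℤ t)) (Aa≡0 i) ⟩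
      x * a i - (a i * x +ℤ + 0)            ≡⟨ cancel x (a i) ⟩
      + 0                                   ∎
      where
      cancel : ∀ x a → x * a - (a * x +ℤ + 0) ≡ + 0
      cancel = solve-∀

  -- This supplies the value at x = 0, where `extend-det` says nothing about the determinant: b
  -- extended by 0 is a null vector of B, as b is orthogonal to a.
  extend-singular : ∀ b {v} → (∀ i → (A · b) i ≡ + 0) → ⟨ a , b ⟩ ≡ + 0 → b v ≡ + 1 →
    det (charMatrix B (+ 0)) ≡ + 0
  extend-singular b {v} Ab≡0 ab≡0 bv≡1 = begin
    det M               ≡⟨ ℤₚ.*-identityˡ (det M) ⟨
    + 1 * det M         ≡⟨ cong (_* det M) bv≡1 ⟨
    h (suc v) * det M   ≡⟨ det-eigenvector M (+ 0) (suc v) h (charMatrix-null B (+ 0) h Bh≡0) ⟩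
    + 0                 ∎
    where
    M : Matrix (suc n)
    M = charMatrix B (+ 0)
    h : Vector (suc n)
    h zero    = + 0
    h (suc i) = b i
    Bh≡0 : ∀ r → (B · h) r ≡ + 0
    Bh≡0 zero    = trans (ℤₚ.+-identityˡ ⟨ a , b ⟩) ab≡0
    Bh≡0 (suc i) = trans (cong (_+ℤ (A · b) i) (ℤₚ.*-zeroʳ (a i))) (trans (ℤₚ.+-identityˡ _) (Ab≡0 i))

  -- For x ≠ 0 the factor x cancels from `extend-det`; at x = 0 both sides vanish, the left one by
  -- `extend-singular`.
  extend-spectrum : ∀ k N b {v} → HasSpectrum± G k N 2 →
    (∀ i → (A · a) i ≡ + 0) → ⟨ a , a ⟩ ≡ + k →
    (∀ i → (A · b) i ≡ + 0) → ⟨ a , b ⟩ ≡ + 0 → b v ≡ + 1 →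
    HasSpectrum± (extend G e) k (suc N) 1
  extend-spectrum k N b spec Aa≡0 aa≡k Ab≡0 ab≡0 bv≡1 x with x ℤ.≟ + 0
  ... | yes refl = trans (extend-singular b Ab≡0 ab≡0 bv≡1) (sym (ℤₚ.*-zeroˡ ((+ 0 * + 0 - + k) ^ℤ suc N)))
  ... | no x≢0 = ℤₚ.*-cancelˡ-≡ x (det (charMatrix B x)) ((x ^ℤ 1) * (X * X ^ℤ N)) {{ℤ.≢-nonZero x≢0}} (begin
    x * det (charMatrix B x)          ≡⟨ extend-det (+ k) Aa≡0 aa≡k x ⟩
    X * det (charMatrix A x)          ≡⟨ cong (X *_) (spec x) ⟩
    X * ((x ^ℤ 2) * X ^ℤ N)           ≡⟨ rearrange x X (X ^ℤ N) ⟩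
    x * ((x ^ℤ 1) * (X * X ^ℤ N))     ∎)
    where
    X : ℤ
    X = x * x - + k
    rearrange : ∀ x X Y → X * (x * (x * + 1) * Y) ≡ x * (x * + 1 * (X * Y))
    rearrange = solve-∀

-- Degrees

∣entry∣≤1 : ∀ e → ∣ entryℤ e ∣ ≤ 1
∣entry∣≤1 none = z≤n
∣entry∣≤1 pos  = s≤s z≤n
∣entry∣≤1 neg  = s≤s z≤n

-- Taking the sign makes this total; it inverts `entryℤ` on -1, 0 and 1.
toEntry : ℤ → Entry
toEntry (+ zero)  = none
toEntry (+ suc _) = pos
toEntry -[1+ _ ]  = neg

entryℤ-toEntry : ∀ z → ∣ z ∣ ≤ 1 → entryℤ (toEntry z) ≡ z
entryℤ-toEntry (+ zero)        _ = refl
entryℤ-toEntry (+ suc zero)    _ = refl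
entryℤ-toEntry -[1+ zero ]     _ = refl
entryℤ-toEntry (+ suc (suc _)) (s≤s ())
entryℤ-toEntry -[1+ suc _ ]    (s≤s ())

square-abs : ∀ z → z * z ≡ + (∣ z ∣ ℕ.* ∣ z ∣)
square-abs (+ z)    = sym (ℤₚ.pos-* z z)
square-abs -[1+ z ] = refl

isEdgeℕ : Entry → ℕ
isEdgeℕ e = if isEdge e then 1 else 0

entry-square : ∀ e → entryℤ e * entryℤ e ≡ + isEdgeℕ e
entry-square none = refl
entry-square pos  = refl
entry-square neg  = refl

-- An entry squares to the indicator of an edge, so the squared norm of an adjacency row is a
-- degree.
sum-entry-squares : ∀ (e : Fin n → Entry) →
  ⟨ entryℤ ∘ e , entryℤ ∘ e ⟩ ≡ + count (isEdge ∘ e)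
sum-entry-squares {zero}  e = refl
sum-entry-squares {suc n} e =
  trans (cong₂ _+ℤ_ (entry-square (e zero)) (sum-entry-squares (e ∘ suc)))
        (sym (ℤₚ.pos-+ (isEdgeℕ (e zero)) (count (isEdge ∘ e ∘ suc))))

==ℕ⇒≡ : ∀ m n → (m ==ℕ n) ≡ true → m ≡ n
==ℕ⇒≡ zero    zero    _  = refl
==ℕ⇒≡ (suc m) (suc n) eq = cong suc (==ℕ⇒≡ m n eq)

-- If f is nonzero at every selected index, each of them contributes at least 1 to the squared norm,
-- since f is integral.
find-zero : ∀ (p : Fin n → Bool) (f : Vector n) →
  (Σ[ w ∈ Fin n ] (p w ≡ true × f w ≡ + 0)) ⊎ (+ count p ℤ.≤ ⟨ f , f ⟩)
find-zero {zero}  p f = inj₂ ℤₚ.≤-refl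
find-zero {suc n} p f with find-zero (p ∘ suc) (f ∘ suc)
... | inj₁ (w , pw , fw) = inj₁ (suc w , pw , fw)
... | inj₂ bound with p zero in p₀ | f zero ℤ.≟ + 0
... | true  | yes f₀≡0 = inj₁ (zero , p₀ , f₀≡0)
... | true  | no  f₀≢0 = inj₂ (ℤₚ.+-mono-≤ one≤ bound)
  where
  one≤ : + 1 ℤ.≤ f zero * f zero
  one≤ = ℤₚ.i<j⇒suc[i]≤j (ℤₚ.≤∧≢⇒< (square-nonneg (f zero)) (f₀≢0 ∘ i²≡0⇒i≡0 (f zero) ∘ sym))
... | false | _        = inj₂ (ℤₚ.+-mono-≤ (square-nonneg (f zero)) bound)

square≤2⇒≤1 : ∀ m → m ℕ.* m ≤ 2 → m ≤ 1
square≤2⇒≤1 zero          _ = z≤n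
square≤2⇒≤1 (suc zero)    _ = s≤s z≤n
square≤2⇒≤1 (suc (suc m)) p = contradiction
  (ℕₚ.≤-trans (ℕₚ.*-mono-≤ {2} {suc (suc m)} {2} {suc (suc m)} (s≤s (s≤s z≤n)) (s≤s (s≤s z≤n))) p)
  (λ { (s≤s (s≤s ())) })

-- Construction of `H`

module Construction (k N : ℕ) {n} (G : SignedGraph n) (spec : HasSpectrum± G k N 2)
  (degrees : ∀ v → degree G v ≡ k ⊎ degree G v + 1 ≡ k ⊎ degree G v + 2 ≡ k)
  (many : suc k ≤ count (λ v → (degree G v + 1) ==ℕ k)) where

  A : Matrix n
  A = adjMatrix G

  A-sym : ∀ i j → A i j ≡ A j i
  A-sym i j = cong entryℤ (symmetric G i j)

  ∣A∣≤1 : ∀ i j → ∣ A i j ∣ ≤ 1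
  ∣A∣≤1 i j = ∣entry∣≤1 (adj G i j)

  Q : Matrix n
  Q = P A (+ k)

  A·Q≡0 : ∀ u i → (A · Q u) i ≡ + 0
  A·Q≡0 = A·P≡0 A (+ k) A-sym ∣A∣≤1 N spec

  Q-diagonal : ∀ w → Q w w +ℤ + degree G w ≡ + k
  Q-diagonal w = begin
    Q w w +ℤ + degree G w
      ≡⟨ cong (_+ℤ + degree G w) (P-diagonal A (+ k) A-sym w) ⟩
    + k - ⟨ A w , A w ⟩ +ℤ + degree G w
      ≡⟨ cong (λ t → + k - t +ℤ + degree G w) (sum-entry-squares (adj G w)) ⟩
    + k - + degree G w +ℤ + degree G w
      ≡⟨ cancel (+ k) (+ degree G w) ⟩
    + k ∎
    where
    cancel : ∀ x d → x - d +ℤ d ≡ x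
    cancel = solve-∀

  inner-Q : ∀ u v → ⟨ Q u , Q v ⟩ ≡ + k * Q u v
  inner-Q u v = inner-P-null A (+ k) A-sym (Q u) v (A·Q≡0 u)

  marked : Fin n → Bool
  marked v = (degree G v + 1) ==ℕ k

  Q-marked : ∀ {v} → marked v ≡ true → Q v v ≡ + 1
  Q-marked {v} mv = ∙-cancelʳ (+ degree G v) (Q v v) (+ 1) (begin
    Q v v +ℤ + degree G v      ≡⟨ Q-diagonal v ⟩
    + k                        ≡⟨ cong +_ (==ℕ⇒≡ _ k mv) ⟨
    + (degree G v + 1)         ≡⟨ cong +_ (ℕₚ.+-comm (degree G v) 1) ⟩
    + 1 +ℤ + degree G v        ∎)

  -- More than k vertices are marked, while a squared norm of at most k allows at most k nonzero
  -- integer entries.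
  marked-orthogonal-to : ∀ f → ⟨ f , f ⟩ ℤ.≤ + k → Σ[ w ∈ Fin n ] (marked w ≡ true × f w ≡ + 0)
  marked-orthogonal-to f ff≤k with find-zero marked f
  ... | inj₁ found = found
  ... | inj₂ bound = contradiction (ℕₚ.≤-trans many (ℤₚ.drop‿+≤+ (ℤₚ.≤-trans bound ff≤k))) ℕₚ.1+n≰n

  -- The zero vector serves only to produce some marked vertex.
  first : Σ[ u ∈ Fin n ] (marked u ≡ true × + 0 ≡ + 0)
  first = marked-orthogonal-to (λ _ → + 0)
    (ℤₚ.≤-trans (ℤₚ.≤-reflexive (inner-zeroʳ {n} (λ _ → + 0) (λ _ → refl))) (+≤+ z≤n))

  u : Fin n
  u = proj₁ first

  Quu : Q u u ≡ + 1
  Quu = Q-marked (proj₁ (proj₂ first))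

  -- The marked vertex u gives k = deg u + 1.
  k≢0 : + k ≢ + 0
  k≢0 k≡0 = ℕₚ.m+1+n≢0 (degree G u) (trans (==ℕ⇒≡ _ k (proj₁ (proj₂ first))) (ℤₚ.+-injective k≡0))

  ⟨Qu,Qu⟩ : ⟨ Q u , Q u ⟩ ≡ + k
  ⟨Qu,Qu⟩ = trans (inner-Q u u) (trans (cong (+ k *_) Quu) (ℤₚ.*-identityʳ (+ k)))

  second : Σ[ v ∈ Fin n ] (marked v ≡ true × Q u v ≡ + 0)
  second = marked-orthogonal-to (Q u) (ℤₚ.≤-reflexive ⟨Qu,Qu⟩)

  v : Fin n
  v = proj₁ second

  Qvv : Q v v ≡ + 1
  Qvv = Q-marked (proj₁ (proj₂ second))

  Quv : Q u v ≡ + 0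
  Quv = proj₂ (proj₂ second)

  a b : Fin n → ℕ
  a w = ∣ Q u w ∣ ℕ.* ∣ Q u w ∣
  b w = ∣ Q v w ∣ ℕ.* ∣ Q v w ∣

  -- Here b w + a w is the diagonal entry `Q w w`. The order of summands lets a w join the degree in
  -- G, forming the degree in `H`.
  degree-split : ∀ w → (b w + a w) + degree G w ≡ k
  degree-split w = ℤₚ.+-injective (begin
    + (b w + a w + degree G w)
      ≡⟨ cong (λ t → + (t + degree G w)) (ℕₚ.+-comm (b w) (a w)) ⟩
    + a w +ℤ + b w +ℤ + degree G w
      ≡⟨ cong₂ (λ s t → s +ℤ t +ℤ + degree G w) (square-abs (Q u w)) (square-abs (Q v w)) ⟨
    Q u w * Q u w +ℤ Q v w * Q v w +ℤ + degree G w
      ≡⟨ cong (_+ℤ + degree G w) (P-diagonal-split A (+ k) A-sym ∣A∣≤1 N spec k≢0 Quu Qvv Quv w) ⟨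
    Q w w +ℤ + degree G w
      ≡⟨ Q-diagonal w ⟩
    + k ∎)

  b+a≤2 : ∀ w → b w + a w ≤ 2
  b+a≤2 w = ℕₚ.+-cancelʳ-≤ (degree G w) (b w + a w) 2
    (ℕₚ.≤-trans (ℕₚ.≤-reflexive (degree-split w)) (k≤ (degrees w)))
    where
    d≡ : ∀ {t} → degree G w + t ≡ k → t ≤ 2 → k ≤ 2 + degree G w
    d≡ {t} refl t≤2 = ℕₚ.≤-trans (ℕₚ.+-monoʳ-≤ (degree G w) t≤2) (ℕₚ.≤-reflexive (ℕₚ.+-comm (degree G w) 2))
    k≤ : degree G w ≡ k ⊎ degree G w + 1 ≡ k ⊎ degree G w + 2 ≡ k → k ≤ 2 + degree G w
    k≤ (inj₁ d)        = d≡ (trans (ℕₚ.+-identityʳ (degree G w)) d) z≤n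
    k≤ (inj₂ (inj₁ d)) = d≡ d (s≤s z≤n)
    k≤ (inj₂ (inj₂ d)) = d≡ d ℕₚ.≤-refl

  e : Fin n → Entry
  e w = toEntry (Q u w)

  entryℤ-e : ∀ w → entryℤ (e w) ≡ Q u w
  entryℤ-e w = entryℤ-toEntry (Q u w)
    (square≤2⇒≤1 ∣ Q u w ∣ (ℕₚ.≤-trans (ℕₚ.m≤n+m (a w) (b w)) (b+a≤2 w)))

  inner-eˡ : ∀ f → ⟨ entryℤ ∘ e , f ⟩ ≡ ⟨ Q u , f ⟩
  inner-eˡ f = sum-cong λ w → cong (_* f w) (entryℤ-e w)

  ⟨e,e⟩ : ⟨ entryℤ ∘ e , entryℤ ∘ e ⟩ ≡ + k
  ⟨e,e⟩ = trans (inner-eˡ (entryℤ ∘ e)) (trans (inner-congʳ (Q u) entryℤ-e) ⟨Qu,Qu⟩)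

  H : SignedGraph (suc n)
  H = extend G e

  H-spectrum : HasSpectrum± H k (suc N) 1
  H-spectrum = extend-spectrum G e k N (Q v) spec
    (λ i → trans (inner-congʳ (A i) entryℤ-e) (A·Q≡0 u i))
    ⟨e,e⟩
    (A·Q≡0 v)
    (trans (inner-eˡ (Q v)) (trans (inner-Q u v) (trans (cong (+ k *_) Quv) (ℤₚ.*-zeroʳ (+ k)))))
    Qvv

  H-degrees : ∀ w → degree H w ≡ k ⊎ degree H w + 1 ≡ k
  -- The degree of the new vertex is the squared norm of `Q u`, which is k.
  H-degrees zero    = inj₁ (ℤₚ.+-injective (trans (sym (sum-entry-squares e)) ⟨e,e⟩))
  -- An old vertex w has degree k - (Q v w)² in `H`, and `Q v w` has absolute value at most 1.
  H-degrees (suc w) = cases ∣ Q v w ∣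
    (square≤2⇒≤1 ∣ Q v w ∣ (ℕₚ.≤-trans (ℕₚ.m≤m+n (b w) (a w)) (b+a≤2 w)))
    (trans (sym (ℕₚ.+-assoc (b w) (a w) (degree G w))) (degree-split w))
    where
    a≡ : isEdgeℕ (e w) ≡ a w
    a≡ = ℤₚ.+-injective (begin
      + isEdgeℕ (e w)                ≡⟨ entry-square (e w) ⟨
      entryℤ (e w) * entryℤ (e w)    ≡⟨ cong₂ _*_ (entryℤ-e w) (entryℤ-e w) ⟩
      Q u w * Q u w                  ≡⟨ square-abs (Q u w) ⟩
      + a w                          ∎)
    degree-H : degree H (suc w) ≡ a w + degree G w
    degree-H = cong (_+ degree G w) a≡
    cases : ∀ β → β ≤ 1 → β ℕ.* β + (a w + degree G w) ≡ k →
      degree H (suc w) ≡ k ⊎ degree H (suc w) + 1 ≡ k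
    cases zero       _ eq = inj₁ (trans degree-H eq)
    cases (suc zero) _ eq = inj₂ (trans (ℕₚ.+-comm (degree H (suc w)) 1) (trans (cong suc degree-H) eq))
    cases (suc (suc _)) (s≤s ()) _

theorem5p7 : (k m n : ℕ) → 2 ≤ m → (G : SignedGraph n)
    → HasSpectrum± G k (m ∸ 2) 2
    → (∀ v → degree G v ≡ k ⊎ degree G v + 1 ≡ k ⊎ degree G v + 2 ≡ k)
    → suc k ≤ count (λ v → (degree G v + 1) ==ℕ k)
    → Σ (SignedGraph (suc n)) (λ H →
    HasSpectrum± H k (m ∸ 1) 1
    × (∀ v → degree H v ≡ k ⊎ degree H v + 1 ≡ k)
    × Σ (Fin (suc n)) (λ v → DeletionYields H v G))
-- With m = N + 2 the exponents m - 2 and m - 1 compute to N and N + 1.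
theorem5p7 k (suc (suc N)) n _ G spec degrees many =
  -- The new vertex is `zero` and `punchIn zero` is `suc`, so deleting it returns the entries of G
  -- by computation.
  H , H-spectrum , H-degrees , zero , λ _ _ → refl
  where open Construction k N G spec degrees many
theorem5p7 k (suc zero) n (s≤s ()) G spec degrees many
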